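{- Let $m\ge 1$ and $N\ge 0$ be integers, and let $$\Delta_N=\det\bigl(\gamma^{(2m)}_{i+j+1-m}(t)\bigr)_{i,j=0}^{N-1}.$$ If $N=mn$ for an integer $n\ge0$, then $\Delta_N=(-1)^{nm(m-1)/2}\, t^{m^2n(n-1)/2}$; otherwise $\Delta_N=0$.
   Context: Let $t$ be an indeterminate. The Narayana polynomials are $\gamma_0(t)=1$ and, for $n\ge1$, $\gamma_n(t)=\sum_{k=0}^{n-1}\binom{n}{k}\binom{n-1}{k}\frac{1}{k+1}t^k$. Their generating function $\gamma(t,q)=\sum_{n\ge0}\gamma_n(t)q^n$ satisfies $-1+(1-q+tq)\gamma(t,q)-tq\,\gamma(t,q)^2=0$. For an integer $m\ge1$, the polynomials $\gamma^{(2m)}_n(t)$, $n\ge0$, are defined by $\sum_{n\ge0}\gamma^{(2m)}_n(t)q^n=\bigl((\gamma(t,q)-1)/q\bigr)^m$, and one sets $\gamma^{(2m)}_i(t)=0$ for $i<0$. The determinant of a $0\times0$ matrix is $1$. -}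

module Defs where

open import Data.Nat as ℕ using (ℕ; zero; suc; _∸_; _≤?_)
open import Data.Nat.Combinatorics using (_C_)
open import Data.Integer as ℤ using (ℤ; +_; -_)
open import Data.Fin using (Fin; zero; suc; toℕ; punchIn)
open import Relation.Nullary using (yes; no)
open import Relation.Binary.PropositionalEquality using (_≡_)

-- Polynomials in t with integer coefficients, as coefficient sequences
-- (coefficient of t^k at index k).  Equality is pointwise (_≈ₚ_).
Poly : Set
Poly = ℕ → ℤ

_≈ₚ_ : Poly → Poly → Set
p ≈ₚ q = ∀ k → p k ≡ q k
infix 4 _≈ₚ_

sumTo : ℕ → (ℕ → ℤ) → ℤ
sumTo zero    f = f 0
sumTo (suc n) f = sumTo n f ℤ.+ f (suc n)

0ₚ : Poly
0ₚ _ = + 0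

1ₚ : Poly
1ₚ zero    = + 1
1ₚ (suc _) = + 0

_+ₚ_ : Poly → Poly → Poly
(p +ₚ q) k = p k ℤ.+ q k

-ₚ_ : Poly → Poly
(-ₚ p) k = - p k

_*ₚ_ : Poly → Poly → Poly
(p *ₚ q) k = sumTo k (λ i → p i ℤ.* q (k ∸ i))

monomial : ℤ → ℕ → Poly
monomial c e k with k ℕ.≟ e
... | yes _ = c
... | no  _ = + 0

-- Narayana polynomials: γ_0 = 1, and for n ≥ 1
-- γ_n(t) = Σ_{k=0}^{n-1} C(n,k) C(n-1,k) /(k+1) t^k
-- (the term vanishes for k ≥ n since C(n-1,k) = 0; division is exact).
narayana : ℕ → Poly
narayana zero    = 1ₚ
narayana (suc n) k = + (((suc n C k) ℕ.* (n C k)) ℕ./ suc k)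

-- Coefficients of q^n in ((γ(t,q) - 1)/q)^m, i.e. γ^{(2m)}_n(t),
-- computed as the m-fold Cauchy power (in q) of the series Σ_n γ_{n+1}(t) q^n.
gamma2m : (m : ℕ) → ℕ → Poly
gamma2m zero    zero    = 1ₚ
gamma2m zero    (suc n) = 0ₚ
gamma2m (suc m) n k =
  sumTo n (λ i → (narayana (suc i) *ₚ gamma2m m (n ∸ i)) k)

entry : (m i j : ℕ) → Poly
entry m i j with m ≤? suc (i ℕ.+ j)
... | yes _ = gamma2m m (suc (i ℕ.+ j) ∸ m)
... | no  _ = 0ₚ

sumFin : ∀ {n} → (Fin n → Poly) → Poly
sumFin {zero}  f = 0ₚ
sumFin {suc n} f = f zero +ₚ sumFin (λ j → f (suc j))

signed : ℕ → Poly → Poly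
signed zero          p = p
signed (suc zero)    p = -ₚ p
signed (suc (suc j)) p = signed j p

det : ∀ {n} → (Fin n → Fin n → Poly) → Poly
det {zero}  M = 1ₚ
det {suc n} M =
  sumFin (λ j → signed (toℕ j)
    (M zero j *ₚ det (λ r c → M (suc r) (punchIn j c))))

Δ : (m N : ℕ) → Poly
Δ m N = det {N} (λ i j → entry m (toℕ i) (toℕ j))

signℤ : ℕ → ℤ
signℤ zero          = + 1
signℤ (suc zero)    = - (+ 1)
signℤ (suc (suc e)) = signℤ e

-- Put w = γ - 1, so that w = q (1 + (1 + t) w + t w²), and W l N = [q^N] w^l.
-- The entries of the matrix are W m (i + j + 1), and x w^l = w^(l-1) + (1 + t) w^l + t w^(l+1)
-- for x = 1/q makes multiplication by x (the shift of a Hankel column) a Jacobi operator.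
-- In terms of its Chebyshev polynomials U_k, the monic polynomial
-- (U_(βm+m-1) / U_(m-1)) U_r of degree r + βm turns column r + βm of the Hankel matrix into
-- t^(βm) Σ_{c ≤ r} t^c W (βm + m - r + 2c) (i + 1), whose first nonzero entry is t^(βm), in row
-- βm + m - 1 - r.  This unitriangular change of columns makes the matrix block lower triangular
-- with antitriangular m × m diagonal blocks; if m does not divide N, the last, incomplete block
-- starts with a zero row.
module Submission where

open import Defs
open import Algebra.Bundles using (CommutativeRing; Semiring)
open import Data.Integer as ℤ using (ℤ; +_; -[1+_])
import Data.Integer.Properties as ℤₚ
import Data.Integer.Tactic.RingSolver as ℤ-Solver
open import Data.Nat as ℕ using (ℕ; zero; suc; _∸_; _/_; _%_; _≤_; _<_; _≥_; z≤n; s≤s)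
open import Data.Nat.Combinatorics using (_C_; nCk+nC[k+1]≡[n+1]C[k+1])
open import Data.Nat.Divisibility using (n∣m*n)
open import Data.Nat.DivMod
  using (m≡m%n+[m/n]*n; m%n<n; [m+kn]%n≡m%n; m<n⇒m%n≡m; m<n⇒m/n≡0; +-distrib-/-∣ʳ; m*n/n≡m; /-monoˡ-≤)
import Data.Nat.Properties as ℕₚ
import Data.Nat.Tactic.RingSolver as ℕ-Solver
open import Data.Product using (_×_; _,_; ∃-syntax)
open import Data.Sum using (_⊎_; inj₁; inj₂)
open import Function using (_∘_)
open import Level using (0ℓ; _⊔_)
open import Relation.Binary.Definitions using (tri<; tri≈; tri>)
open import Relation.Binary.PropositionalEquality as ≡ using (_≡_; _≢_)
open import Relation.Nullary using (yes; no; contradiction)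

-- Why the quotient by U_(m-1): since x - (1 + t) = 1/w + t w, one has U_k = Σ_{c ≤ k} t^c w^(2c-k)
-- and U_(βm+m-1) / U_(m-1) = Σ_{c ≤ β} t^(cm) w^(m(2c-β)). Applied to w^m, the series behind column
-- 0, this gives Σ_{c ≤ β} t^(cm) w^(m(2c-β+1)). For c < β the terms c and β-1-c together form a
-- multiple of some w^(-a) + (t w)^a (or a constant, if they coincide). Being symmetric in 1/w and t
-- w, this is a polynomial in x, and the rows cannot see it because they read only positive powers
-- of q. Only t^(βm) w^(m(β+1)) survives; multiplication by U_r with r < m keeps its exponents
-- positive. Neither the quotient nor any polynomial in x has to be formed: each new column is
-- obtained from the shift of its predecessor, up to a combination of earlier columns. A separate
-- obstacle is that the Narayana polynomials are given by quotients of binomials and not by the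
-- equation for w. The bridge is a closed form for all W l N, not only for l = 1, because the
-- recurrence mixes three values of l.

-- Column indices of a minor

skip : ℕ → ℕ → ℕ
skip zero    c       = suc c
skip (suc j) zero    = zero
skip (suc j) (suc c) = suc (skip j c)

skip-< : ∀ j {c n} → c < n → skip j c < suc n
skip-< zero            c<n       = s≤s c<n
skip-< (suc j) {zero}  c<n       = s≤s z≤n
skip-< (suc j) {suc c} (s≤s c<n) = s≤s (skip-< j c<n)

skip-≢ : ∀ j c → skip j c ≢ j
skip-≢ (suc j) (suc c) eq = skip-≢ j c (ℕₚ.suc-injective eq)

skip-injective : ∀ j {c d} → skip j c ≡ skip j d → c ≡ d
skip-injective zero                    eq = ℕₚ.suc-injective eq
skip-injective (suc j) {zero}  {zero}  eq = ≡.refl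
skip-injective (suc j) {suc c} {suc d} eq =
  ≡.cong suc (skip-injective j (ℕₚ.suc-injective eq))

skip-below : ∀ {j c} → c < j → skip j c ≡ c
skip-below {suc j} {zero}  _         = ≡.refl
skip-below {suc j} {suc c} (s≤s c<j) = ≡.cong suc (skip-below c<j)

skip-above : ∀ {j c} → j ≤ c → skip j c ≡ suc c
skip-above {zero}           _         = ≡.refl
skip-above {suc j} {suc c}  (s≤s j≤c) = ≡.cong suc (skip-above j≤c)

unskip : ∀ {n} k j → k ≢ j → k < suc n → j < suc n → ∃[ j′ ] j′ < n × skip k j′ ≡ j
unskip zero    zero    k≢j _ _ = contradiction ≡.refl k≢j
unskip zero    (suc j) _   _ (s≤s j<n) = j , j<n , ≡.refl
unskip {suc n} (suc k) zero    _   _ _ = 0 , s≤s z≤n , ≡.refl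
unskip {zero}  (suc k) zero    _   (s≤s ()) _
unskip {suc n} (suc k) (suc j) k≢j (s≤s k<n) (s≤s j<n) with unskip k j (k≢j ∘ ≡.cong suc) k<n j<n
... | j′ , j′<n , eq = suc j′ , s≤s j′<n , ≡.cong suc eq

-- Needed for the induction on the size in `detℕ-adjacent`: a deleted column outside an adjacent
-- pair never lies between its members, so the pair stays adjacent in the minor.
skip-adjacent : ∀ {n} j a → j ≢ a → j ≢ suc a → j < suc n → suc a < suc n →
                ∃[ a′ ] suc a′ < n × skip j a′ ≡ a × skip j (suc a′) ≡ suc a
skip-adjacent zero    zero    j≢a _ _ _ = contradiction ≡.refl j≢a
skip-adjacent zero    (suc a) _ _ _ (s≤s a<n) = a , a<n , ≡.refl , ≡.refl
skip-adjacent (suc zero)    zero _ j≢1 _ _ = contradiction ≡.refl j≢1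
skip-adjacent (suc (suc j)) zero _ _ (s≤s j<n) _ =
  0 , ℕₚ.≤-trans (s≤s (s≤s z≤n)) j<n , ≡.refl , ≡.refl
skip-adjacent {suc n} (suc j) (suc a) j≢a j≢1+a (s≤s j<n) (s≤s a<n)
  with skip-adjacent j a (j≢a ∘ ≡.cong suc) (j≢1+a ∘ ≡.cong suc) j<n a<n
... | a′ , a′<n , eq , eq′ = suc a′ , s≤s a′<n , ≡.cong suc eq , ≡.cong suc eq′

-- The two enumerations differ only at `c = a`, where each picks the column that the other one
-- deletes. If these columns are equal, so are the two minors.
skip-suc : ∀ a c → skip a c ≡ skip (suc a) c ⊎ (skip a c ≡ suc a × skip (suc a) c ≡ a)
skip-suc zero    zero    = inj₂ (≡.refl , ≡.refl)
skip-suc zero    (suc c) = inj₁ ≡.refl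
skip-suc (suc a) zero    = inj₁ ≡.refl
skip-suc (suc a) (suc c) with skip-suc a c
... | inj₁ eq         = inj₁ (≡.cong suc eq)
... | inj₂ (eq , eq′) = inj₂ (≡.cong suc eq , ≡.cong suc eq′)

triangle : ℕ → ℕ
triangle zero    = 0
triangle (suc n) = n ℕ.+ triangle n

-- Determinants over a commutative ring

module Determinant {c ℓ} (R : CommutativeRing c ℓ) where
  open CommutativeRing R
  open import Algebra.Definitions.RawSemiring (Semiring.rawSemiring semiring) using (_^_)
  open import Algebra.Properties.Ring ring using (-1*x≈-x)
  open import Algebra.Properties.Semiring.Exp semiring using (^-homo-*; ^-congʳ)
  open import Algebra.Solver.Ring.NaturalCoefficients.Default commutativeSemiring
  open import Relation.Binary.Reasoning.Setoid setoid

  -- A matrix is given by its columns: v j i is the entry in column j and row i.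
  Column : Set c
  Column = ℕ → Carrier

  ε : Carrier
  ε = - 1#

  x+εx≈0 : ∀ x → x + ε * x ≈ 0#
  x+εx≈0 x = trans (+-congˡ (-1*x≈-x x)) (-‿inverseʳ x)

  x≈x+x⇒x≈0 : ∀ {x} → x ≈ x + x → x ≈ 0#
  x≈x+x⇒x≈0 {x} eq = begin
    x                  ≈⟨ +-identityʳ x ⟨
    x + 0#             ≈⟨ +-congˡ (x+εx≈0 x) ⟨
    x + (x + ε * x)    ≈⟨ +-assoc x x (ε * x) ⟨
    x + x + ε * x      ≈⟨ +-congʳ eq ⟨
    x + ε * x          ≈⟨ x+εx≈0 x ⟩
    0#                 ∎

  -- Horner form: the signs are nested factors `ε`, so inductions peel off the head without parity
  -- cases.
  altSum : ℕ → (ℕ → Carrier) → Carrier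
  altSum zero    g = 0#
  altSum (suc n) g = g 0 + ε * altSum n (g ∘ suc)

  altSum-cong : ∀ n {g h} → (∀ j → j < n → g j ≈ h j) → altSum n g ≈ altSum n h
  altSum-cong zero    eq = refl
  altSum-cong (suc n) eq =
    +-cong (eq 0 (s≤s z≤n)) (*-congˡ (altSum-cong n λ j j<n → eq (suc j) (s≤s j<n)))

  altSum-linear : ∀ n g s h → altSum n (λ j → g j + s * h j) ≈ altSum n g + s * altSum n h
  altSum-linear zero    g s h = solve 1 (λ s → con 0 := con 0 :+ s :* con 0) refl s
  altSum-linear (suc n) g s h = begin
    g 0 + s * h 0 + ε * altSum n (λ j → g (suc j) + s * h (suc j))
      ≈⟨ +-congˡ (*-congˡ (altSum-linear n (g ∘ suc) s (h ∘ suc))) ⟩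
    g 0 + s * h 0 + ε * (altSum n (g ∘ suc) + s * altSum n (h ∘ suc))
      ≈⟨ solve 6 (λ a s b e x y → a :+ s :* b :+ e :* (x :+ s :* y)
                               := a :+ e :* x :+ s :* (b :+ e :* y)) refl _ _ _ _ _ _ ⟩
    g 0 + ε * altSum n (g ∘ suc) + s * (h 0 + ε * altSum n (h ∘ suc)) ∎

  altSum-zero : ∀ n {g} → (∀ j → j < n → g j ≈ 0#) → altSum n g ≈ 0#
  altSum-zero zero    eq = refl
  altSum-zero (suc n) eq = begin
    _ ≈⟨ +-cong (eq 0 (s≤s z≤n)) (*-congˡ (altSum-zero n λ j j<n → eq (suc j) (s≤s j<n))) ⟩
    0# + ε * 0# ≈⟨ solve 1 (λ e → con 0 :+ e :* con 0 := con 0) refl ε ⟩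
    0# ∎

  altSum-single : ∀ n {g} a → a < n → (∀ j → j < n → j ≢ a → g j ≈ 0#) →
                  altSum n g ≈ ε ^ a * g a
  altSum-single (suc n) {g} zero a<n eq = begin
    g 0 + ε * altSum n (g ∘ suc)
      ≈⟨ +-congˡ (*-congˡ (altSum-zero n λ j j<n → eq (suc j) (s≤s j<n) λ ())) ⟩
    g 0 + ε * 0# ≈⟨ solve 2 (λ e x → x :+ e :* con 0 := con 1 :* x) refl ε _ ⟩
    1# * g 0 ∎
  altSum-single (suc n) {g} (suc a) (s≤s a<n) eq = begin
    g 0 + ε * altSum n (g ∘ suc)
      ≈⟨ +-cong (eq 0 (s≤s z≤n) λ ())
                (*-congˡ (altSum-single n a a<n λ j j<n j≢a →
                            eq (suc j) (s≤s j<n) (j≢a ∘ ℕₚ.suc-injective))) ⟩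
    0# + ε * (ε ^ a * g (suc a)) ≈⟨ +-identityˡ _ ⟩
    ε * (ε ^ a * g (suc a)) ≈⟨ *-assoc _ _ _ ⟨
    ε * ε ^ a * g (suc a) ∎

  altSum-cancel : ∀ n {g} a → suc a < n →
                  (∀ j → j < n → j ≢ a → j ≢ suc a → g j ≈ 0#) → g a ≈ g (suc a) →
                  altSum n g ≈ 0#
  altSum-cancel (suc (suc n)) {g} zero _ eq ga≈ = begin
    g 0 + ε * (g 1 + ε * altSum n (g ∘ suc ∘ suc))
      ≈⟨ +-cong ga≈ (*-congˡ (+-congˡ (*-congˡ
           (altSum-zero n λ j j<n → eq (2 ℕ.+ j) (s≤s (s≤s j<n)) (λ ()) λ ())))) ⟩
    g 1 + ε * (g 1 + ε * 0#)
      ≈⟨ solve 2 (λ e x → x :+ e :* (x :+ e :* con 0) := x :+ e :* x) refl ε (g 1) ⟩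
    g 1 + ε * g 1 ≈⟨ x+εx≈0 (g 1) ⟩
    0# ∎
  altSum-cancel (suc n) {g} (suc a) (s≤s a<n) eq ga≈ = begin
    g 0 + ε * altSum n (g ∘ suc)
      ≈⟨ +-cong (eq 0 (s≤s z≤n) (λ ()) λ ())
                (*-congˡ (altSum-cancel n a a<n (λ j j<n j≢a j≢1+a →
                   eq (suc j) (s≤s j<n) (j≢a ∘ ℕₚ.suc-injective) (j≢1+a ∘ ℕₚ.suc-injective)) ga≈)) ⟩
    0# + ε * 0# ≈⟨ solve 1 (λ e → con 0 :+ e :* con 0 := con 0) refl ε ⟩
    0# ∎

  minor : (ℕ → Column) → ℕ → ℕ → Column
  minor v j c i = v (skip j c) (suc i)

  -- Laplace expansion along row 0. Columns are infinite and the size is a mere number, so shifted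
  -- columns and trailing blocks need no casts.
  detℕ : ℕ → (ℕ → Column) → Carrier
  detℕ zero    v = 1#
  detℕ (suc n) v = altSum (suc n) (λ j → v j 0 * detℕ n (minor v j))

  detℕ-cong : ∀ n {v w} → (∀ j → j < n → ∀ i → v j i ≈ w j i) → detℕ n v ≈ detℕ n w
  detℕ-cong zero    eq = refl
  detℕ-cong (suc n) eq = altSum-cong (suc n) λ j j<n →
    *-cong (eq j j<n 0) (detℕ-cong n λ k k<n i → eq (skip j k) (skip-< j k<n) (suc i))

  detℕ-linear : ∀ n {x v w s} j → j < n →
                (∀ k → k ≢ j → ∀ i → x k i ≈ v k i) →
                (∀ k → k ≢ j → ∀ i → x k i ≈ w k i) →
                (∀ i → x j i ≈ v j i + s * w j i) →
                detℕ n x ≈ detℕ n v + s * detℕ n w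
  detℕ-linear (suc n) {x} {v} {w} {s} j j<n x≈v x≈w xj =
    trans (altSum-cong (suc n) term)
          (altSum-linear (suc n) (λ k → v k 0 * detℕ n (minor v k)) s (λ k → w k 0 * detℕ n (minor w k)))
    where
    term : ∀ k → k < suc n → x k 0 * detℕ n (minor x k) ≈
           v k 0 * detℕ n (minor v k) + s * (w k 0 * detℕ n (minor w k))
    term k k<n with k ℕ.≟ j
    ... | yes ≡.refl = begin
      x k 0 * detℕ n (minor x k) ≈⟨ *-congʳ (xj 0) ⟩
      (v k 0 + s * w k 0) * detℕ n (minor x k)
        ≈⟨ solve 4 (λ a s b d → (a :+ s :* b) :* d := a :* d :+ s :* (b :* d)) refl _ _ _ _ ⟩
      v k 0 * detℕ n (minor x k) + s * (w k 0 * detℕ n (minor x k))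
        ≈⟨ +-cong (*-congˡ (detℕ-cong n λ c _ i → x≈v (skip k c) (skip-≢ k c) (suc i)))
                  (*-congˡ (*-congˡ (detℕ-cong n λ c _ i → x≈w (skip k c) (skip-≢ k c) (suc i)))) ⟩
      v k 0 * detℕ n (minor v k) + s * (w k 0 * detℕ n (minor w k)) ∎
    ... | no k≢j with unskip k j k≢j k<n j<n
    ...   | j′ , j′<n , ≡.refl = begin
      x k 0 * detℕ n (minor x k)
        ≈⟨ *-congˡ (detℕ-linear n j′ j′<n
             (λ c c≢ i → x≈v (skip k c) (c≢ ∘ skip-injective k) (suc i))
             (λ c c≢ i → x≈w (skip k c) (c≢ ∘ skip-injective k) (suc i))
             (λ i → xj (suc i))) ⟩
      x k 0 * (detℕ n (minor v k) + s * detℕ n (minor w k))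
        ≈⟨ solve 4 (λ a p s q → a :* (p :+ s :* q) := a :* p :+ s :* (a :* q)) refl _ _ _ _ ⟩
      x k 0 * detℕ n (minor v k) + s * (x k 0 * detℕ n (minor w k))
        ≈⟨ +-cong (*-congʳ (x≈v k k≢j 0)) (*-congˡ (*-congʳ (x≈w k k≢j 0))) ⟩
      v k 0 * detℕ n (minor v k) + s * (w k 0 * detℕ n (minor w k)) ∎

  -- In the expansion along row 0, the minors that keep both columns vanish by induction; the other
  -- two terms are equal and carry opposite signs.
  detℕ-adjacent : ∀ n {v} a → suc a < n → (∀ i → v a i ≈ v (suc a) i) → detℕ n v ≈ 0#
  detℕ-adjacent (suc n) {v} a a<n eq = altSum-cancel (suc n) a a<n other same
    where
    other : ∀ j → j < suc n → j ≢ a → j ≢ suc a → v j 0 * detℕ n (minor v j) ≈ 0#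
    other j j<n j≢a j≢1+a with skip-adjacent j a j≢a j≢1+a j<n a<n
    ... | a′ , a′<n , e , e′ = trans (*-congˡ (detℕ-adjacent n a′ a′<n λ i →
            trans (reflexive (≡.cong (λ k → v k (suc i)) e))
              (trans (eq (suc i)) (reflexive (≡.cong (λ k → v k (suc i)) (≡.sym e′))))))
            (zeroʳ _)
    minors : ∀ c i → minor v a c i ≈ minor v (suc a) c i
    minors c i with skip-suc a c
    ... | inj₁ e        = reflexive (≡.cong (λ k → v k (suc i)) e)
    ... | inj₂ (e , e′) = trans (reflexive (≡.cong (λ k → v k (suc i)) e))
            (trans (sym (eq (suc i))) (reflexive (≡.cong (λ k → v k (suc i)) (≡.sym e′))))
    same : v a 0 * detℕ n (minor v a) ≈ v (suc a) 0 * detℕ n (minor v (suc a))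
    same = *-cong (eq 0) (detℕ-cong n λ c _ → minors c)

  put : (ℕ → Column) → ℕ → Column → ℕ → Column
  put v j x k with k ℕ.≟ j
  ... | yes _ = x
  ... | no  _ = v k

  put-same : ∀ v j x i → put v j x j i ≈ x i
  put-same v j x i with j ℕ.≟ j
  ... | yes _  = refl
  ... | no j≢j = contradiction ≡.refl j≢j

  put-other : ∀ v j x k → k ≢ j → ∀ i → put v j x k i ≈ v k i
  put-other v j x k k≢j i with k ℕ.≟ j
  ... | yes k≡j = contradiction k≡j k≢j
  ... | no  _   = refl

  detℕ-put-linear : ∀ n {v s} j {x y z} → j < n → (∀ i → x i ≈ y i + s * z i) →
    detℕ n (put v j x) ≈ detℕ n (put v j y) + s * detℕ n (put v j z)
  detℕ-put-linear n {v} {s} j {x} {y} {z} j<n eq = detℕ-linear n j j<n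
    (λ k k≢j i → trans (put-other v j x k k≢j i) (sym (put-other v j y k k≢j i)))
    (λ k k≢j i → trans (put-other v j x k k≢j i) (sym (put-other v j z k k≢j i)))
    (λ i → trans (put-same v j x i) (trans (eq i)
       (sym (+-cong (put-same v j y i) (*-congˡ (put-same v j z i))))))

  put-put-same : ∀ v j x i y → put (put v j x) (suc j) y j i ≈ x i
  put-put-same v j x i y =
    trans (put-other _ (suc j) y j (ℕₚ.<⇒≢ ℕₚ.≤-refl) i) (put-same v j x i)

  -- The columns with index j and suc j are replaced by all combinations of the two;
  -- the induction hypothesis kills those where the column of index j is z.
  detℕ-alternating : ∀ n {v} d a → suc (d ℕ.+ a) < n →
                     (∀ i → v a i ≈ v (suc (d ℕ.+ a)) i) → detℕ n v ≈ 0#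
  detℕ-alternating n     zero    a lt eq = detℕ-adjacent n a lt eq
  detℕ-alternating n {v} (suc d) a lt eq = begin
    detℕ n v ≈⟨ detℕ-cong n (λ k _ → restore k) ⟩
    P y z    ≈⟨ +-identityʳ (P y z) ⟨
    P y z + 0#           ≈⟨ +-congˡ (trans (*-identityˡ _) (P-diag z)) ⟨
    P y z + 1# * P z z   ≈⟨ P-linˡ z ⟨
    P y+z z              ≈⟨ +-identityˡ (P y+z z) ⟨
    0# + P y+z z         ≈⟨ +-cong P-y (*-identityˡ _) ⟨
    P y+z y + 1# * P y+z z ≈⟨ P-linʳ y+z ⟨
    P y+z y+z            ≈⟨ P-diag y+z ⟩
    0#                   ∎
    where
    j = suc (d ℕ.+ a)
    y = v j
    z = v (suc j)
    y+z : Column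
    y+z i = y i + 1# * z i
    P : Column → Column → Carrier
    P x x′ = detℕ n (put (put v j x) (suc j) x′)
    j<n : j < n
    j<n = ℕₚ.<-trans ℕₚ.≤-refl lt
    restore : ∀ k i → v k i ≈ put (put v j y) (suc j) z k i
    restore k i with k ℕ.≟ suc j
    ... | yes ≡.refl = refl
    ... | no  _ with k ℕ.≟ j
    ...   | yes ≡.refl = refl
    ...   | no  _      = refl
    P-diag : ∀ x → P x x ≈ 0#
    P-diag x = detℕ-adjacent n j lt λ i →
      trans (put-put-same v j x i x) (sym (put-same _ (suc j) x i))
    P-linʳ : ∀ x → P x y+z ≈ P x y + 1# * P x z
    P-linʳ x = detℕ-put-linear n (suc j) lt (λ i → refl)
    P-linˡ : ∀ x → P y+z x ≈ P y x + 1# * P z x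
    P-linˡ x = detℕ-linear n j j<n (other y) (other z) λ i →
      trans (put-put-same v j y+z i x)
        (sym (+-cong (put-put-same v j y i x) (*-congˡ (put-put-same v j z i x))))
      where
      other : ∀ u k → k ≢ j → ∀ i → put (put v j y+z) (suc j) x k i ≈ put (put v j u) (suc j) x k i
      other u k k≢j i with k ℕ.≟ suc j
      ... | yes _ = refl
      ... | no  _ = trans (put-other v j y+z k k≢j i) (sym (put-other v j u k k≢j i))
    P-y : P y+z y ≈ 0#
    P-y = trans (P-linˡ y) (trans (+-cong (P-diag y) (trans (*-identityˡ _) P-z)) (+-identityˡ 0#))
      where
      a≢j : a ≢ j
      a≢j = ℕₚ.<⇒≢ (s≤s (ℕₚ.m≤n+m a d))
      a≢1+j : a ≢ suc j
      a≢1+j = ℕₚ.<⇒≢ (ℕₚ.m≤n⇒m≤1+n (s≤s (ℕₚ.m≤n+m a d)))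
      P-z : P z y ≈ 0#
      P-z = detℕ-alternating n d a j<n λ i →
        trans (put-other _ (suc j) y a a≢1+j i)
          (trans (put-other v j z a a≢j i) (trans (eq i) (sym (put-put-same v j z i y))))

  -- Column operations and block expansion

  data Span (v : ℕ → Column) (j : ℕ) : Column → Set (c ⊔ ℓ) where
    none     : ∀ {x} → (∀ i → x i ≈ 0#) → Span v j x
    column   : ∀ {x} k → k < j → (∀ i → x i ≈ v k i) → Span v j x
    combine  : ∀ {x y z} s → Span v j x → Span v j y → (∀ i → z i ≈ x i + s * y i) → Span v j z

  span-weaken : ∀ {v j k x} → j ≤ k → Span v j x → Span v k x
  span-weaken j≤k (none eq)          = none eq
  span-weaken j≤k (column l l<j eq)  = column l (ℕₚ.<-≤-trans l<j j≤k) eq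
  span-weaken j≤k (combine s x y eq) = combine s (span-weaken j≤k x) (span-weaken j≤k y) eq

  span-cong : ∀ {v w j x} → (∀ k → k < j → ∀ i → v k i ≈ w k i) → Span v j x → Span w j x
  span-cong v≈w (none eq)          = none eq
  span-cong v≈w (column l l<j eq)  = column l l<j (λ i → trans (eq i) (v≈w l l<j i))
  span-cong v≈w (combine s x y eq) = combine s (span-cong v≈w x) (span-cong v≈w y) eq

  span-scale : ∀ {v j x y} s → Span v j x → (∀ i → y i ≈ s * x i) → Span v j y
  span-scale s x eq = combine s (none λ i → refl) x (λ i → trans (eq i) (sym (+-identityˡ _)))

  detℕ-put-span : ∀ n {v x} j → j < n → Span v j x → detℕ n (put v j x) ≈ 0#
  -- A zero column is the sum of itself with itself, so by linearity the determinant equals its own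
  -- double.
  detℕ-put-span n {v} {x} j j<n (none eq) = x≈x+x⇒x≈0 (trans
    (detℕ-put-linear n j j<n λ i → trans (eq i)
      (trans (sym (+-identityˡ 0#)) (+-cong (sym (eq i)) (trans (sym (eq i)) (sym (*-identityˡ _))))))
    (+-congˡ (*-identityˡ _)))
  -- Columns `k` and `j` now coincide; `j ∸ suc k` counts the columns between them.
  detℕ-put-span n {v} {x} j j<n (column k k<j eq) =
          detℕ-alternating n (j ℕ.∸ suc k) k (≡.subst (_< n) (≡.sym gap) j<n) λ i →
          trans (put-other v j x k (ℕₚ.<⇒≢ k<j) i) (trans (sym (eq i))
            (trans (sym (put-same v j x i)) (reflexive (≡.cong (λ l → put v j x l i) (≡.sym gap)))))
    where
    gap : suc (j ℕ.∸ suc k ℕ.+ k) ≡ j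
    gap = ≡.trans (≡.sym (ℕₚ.+-suc (j ℕ.∸ suc k) k)) (ℕₚ.m∸n+n≡m k<j)
  detℕ-put-span n {v} j j<n (combine {x} {y} {z} s X Y eq) = begin
    detℕ n (put v j z) ≈⟨ detℕ-put-linear n j j<n eq ⟩
    detℕ n (put v j x) + s * detℕ n (put v j y)
      ≈⟨ +-cong (detℕ-put-span n j j<n X) (*-congˡ (detℕ-put-span n j j<n Y)) ⟩
    0# + s * 0# ≈⟨ solve 1 (λ s → con 0 :+ s :* con 0 := con 0) refl s ⟩
    0# ∎

  -- For Hankel columns: `x` is the image of column 0 under a monic polynomial of degree `j` in the
  -- shift.
  Leads : (ℕ → Column) → ℕ → Column → Set (c ⊔ ℓ)
  Leads v j x = ∃[ y ] Span v j y × (∀ i → x i ≈ v j i + y i)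

  leads⇒span : ∀ {v j x} → Leads v j x → Span v (suc j) x
  leads⇒span {j = j} (y , Y , eq) = combine 1# (column j ℕₚ.≤-refl λ i → refl)
    (span-weaken (ℕₚ.n≤1+n j) Y) (λ i → trans (eq i) (+-congˡ (sym (*-identityˡ _))))

  -- Columns are exchanged one at a time from the left. When column `k` is exchanged, the earlier
  -- ones are already those of `v`, so the correction `y` lies in the span of columns that are
  -- present and contributes nothing.
  detℕ-unitriangular : ∀ n {v w} → (∀ j → j < n → Leads v j (w j)) → detℕ n w ≈ detℕ n v
  detℕ-unitriangular n {v} {w} leads = trans (sym (replaced n ℕₚ.≤-refl)) (detℕ-cong n all)
    where
    hybrid : ℕ → ℕ → Column
    hybrid k j with j ℕ.<? k
    ... | yes _ = v j
    ... | no  _ = w j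
    hybrid-< : ∀ k j → j < k → ∀ i → hybrid k j i ≈ v j i
    hybrid-< k j j<k i with j ℕ.<? k
    ... | yes _  = refl
    ... | no j≮k = contradiction j<k j≮k
    hybrid-≮ : ∀ k j → k ≤ j → ∀ i → hybrid k j i ≈ w j i
    hybrid-≮ k j k≤j i with j ℕ.<? k
    ... | yes j<k = contradiction j<k (ℕₚ.≤⇒≯ k≤j)
    ... | no _    = refl
    all : ∀ j → j < n → ∀ i → hybrid n j i ≈ v j i
    all = hybrid-< n
    unchanged : ∀ k j → j ≢ k → ∀ i → hybrid k j i ≈ hybrid (suc k) j i
    unchanged k j j≢k i with ℕₚ.<-cmp j k
    ... | tri< j<k _ _ = trans (hybrid-< k j j<k i) (sym (hybrid-< (suc k) j (ℕₚ.m≤n⇒m≤1+n j<k) i))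
    ... | tri≈ _ j≡k _ = contradiction j≡k j≢k
    ... | tri> _ _ k<j = trans (hybrid-≮ k j (ℕₚ.<⇒≤ k<j) i) (sym (hybrid-≮ (suc k) j k<j i))
    replaced : ∀ k → k ≤ n → detℕ n (hybrid k) ≈ detℕ n w
    replaced zero    _   = detℕ-cong n λ j _ → hybrid-≮ 0 j z≤n
    replaced (suc k) k<n with leads k k<n
    ... | y , Y , eq = begin
      detℕ n (hybrid (suc k))        ≈⟨ +-identityʳ _ ⟨
      detℕ n (hybrid (suc k)) + 0#
        ≈⟨ +-congˡ (trans (*-identityˡ _) (detℕ-put-span n k k<n Y′)) ⟨
      detℕ n (hybrid (suc k)) + 1# * detℕ n (put (hybrid (suc k)) k y)
        ≈⟨ detℕ-linear n k k<n (unchanged k)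
             (λ j j≢k i → trans (unchanged k j j≢k i) (sym (put-other _ k y j j≢k i)))
             (λ i → trans (hybrid-≮ k k ℕₚ.≤-refl i) (trans (eq i)
                (+-cong (sym (hybrid-< (suc k) k ℕₚ.≤-refl i))
                        (sym (trans (*-identityˡ _) (put-same _ k y i)))))) ⟨
      detℕ n (hybrid k)              ≈⟨ replaced k (ℕₚ.<⇒≤ k<n) ⟩
      detℕ n w                       ∎
      where
      Y′ : Span (hybrid (suc k)) k y
      Y′ = span-cong (λ j j<k i → sym (hybrid-< (suc k) j (ℕₚ.m≤n⇒m≤1+n j<k) i)) Y

  detℕ-zero-row : ∀ n {v} → (∀ j → j < suc n → v j 0 ≈ 0#) → detℕ (suc n) v ≈ 0#
  detℕ-zero-row n {v} eq = altSum-zero (suc n) λ j j<n →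
    trans (*-congʳ (eq j j<n)) (zeroˡ (detℕ n (minor v j)))

  -- Row 0 can be nonzero only in column `r - 1`; deleting both leaves a matrix of the same shape
  -- with `r` lowered by one. The sign exponents add up to 0 + 1 + ... + (r - 1).
  detℕ-antitriangular : ∀ r n {v x} →
    (∀ k i → suc (k ℕ.+ i) < r → v k i ≈ 0#) →
    (∀ k i → suc (k ℕ.+ i) ≡ r → v k i ≈ x) →
    (∀ k i → r ≤ k → i < r → v k i ≈ 0#) →
    detℕ (r ℕ.+ n) v ≈
      ε ^ triangle r * (x ^ r * detℕ n (λ k i → v (r ℕ.+ k) (r ℕ.+ i)))
  detℕ-antitriangular zero    n above diagonal right =
    sym (trans (*-identityˡ _) (*-identityˡ _))
  detℕ-antitriangular (suc r) n {v} {x} above diagonal right = begin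
    detℕ (suc r ℕ.+ n) v
      ≈⟨ altSum-single (suc r ℕ.+ n) r (s≤s (ℕₚ.m≤m+n r n)) other ⟩
    ε ^ r * (v r 0 * detℕ (r ℕ.+ n) (minor v r))
      ≈⟨ *-congˡ (*-cong (diagonal r 0 (≡.cong suc (ℕₚ.+-identityʳ r)))
                         (detℕ-antitriangular r n above′ diagonal′ right′)) ⟩
    ε ^ r * (x * (ε ^ triangle r * (x ^ r * detℕ n (λ k i → minor v r (r ℕ.+ k) (r ℕ.+ i)))))
      ≈⟨ solve 5 (λ a x b y d → a :* (x :* (b :* (y :* d))) := a :* b :* (x :* y :* d))
           refl _ _ _ _ _ ⟩
    ε ^ r * ε ^ triangle r * (x ^ suc r * detℕ n (λ k i → minor v r (r ℕ.+ k) (r ℕ.+ i)))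
      ≈⟨ *-cong (sym (^-homo-* ε r (triangle r))) (*-congˡ (detℕ-cong n λ k _ i → reflexive
           (≡.cong (λ l → v l (suc (r ℕ.+ i))) (skip-above (ℕₚ.m≤m+n r k))))) ⟩
    ε ^ triangle (suc r) * (x ^ suc r * detℕ n (λ k i → v (suc r ℕ.+ k) (suc r ℕ.+ i))) ∎
    where
    other : ∀ j → j < suc r ℕ.+ n → j ≢ r → v j 0 * detℕ (r ℕ.+ n) (minor v j) ≈ 0#
    other j _ j≢r = trans (*-congʳ lemma) (zeroˡ _)
      where
      lemma : v j 0 ≈ 0#
      lemma with ℕₚ.<-cmp j r
      ... | tri< j<r _ _ = above j 0 (s≤s (≡.subst (_< r) (≡.sym (ℕₚ.+-identityʳ j)) j<r))
      ... | tri≈ _ j≡r _ = contradiction j≡r j≢r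
      ... | tri> _ _ r<j = right j 0 r<j (s≤s z≤n)
    at-skip : ∀ {k i} → k < r → minor v r k i ≈ v k (suc i)
    at-skip k<r = reflexive (≡.cong (λ l → v l (suc _)) (skip-below k<r))
    above′ : ∀ k i → suc (k ℕ.+ i) < r → minor v r k i ≈ 0#
    above′ k i lt = trans (at-skip (ℕₚ.≤-<-trans (ℕₚ.m≤n⇒m≤1+n (ℕₚ.m≤m+n k i)) lt))
      (above k (suc i) (s≤s (≡.subst (_< r) (≡.sym (ℕₚ.+-suc k i)) lt)))
    diagonal′ : ∀ k i → suc (k ℕ.+ i) ≡ r → minor v r k i ≈ x
    diagonal′ k i eq = trans (at-skip (≡.subst (k <_) eq (s≤s (ℕₚ.m≤m+n k i))))
      (diagonal k (suc i) (≡.cong suc (≡.trans (ℕₚ.+-suc k i) eq)))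
    right′ : ∀ k i → r ≤ k → i < r → minor v r k i ≈ 0#
    right′ k i r≤k i<r = trans (reflexive (≡.cong (λ l → v l (suc i)) (skip-above r≤k)))
      (right (suc k) (suc i) (s≤s r≤k) (s≤s i<r))

-- Coefficients of the powers of w

module MotzkinHankel {c ℓ} (R : CommutativeRing c ℓ) (b t : CommutativeRing.Carrier R) where
  open CommutativeRing R
  open Determinant R
  open import Algebra.Definitions.RawSemiring (Semiring.rawSemiring semiring) using (_^_)
  open import Algebra.Properties.Semiring.Exp semiring using (^-homo-*; ^-congʳ; ^-assocʳ)
  open import Algebra.Solver.Ring.NaturalCoefficients.Default commutativeSemiring
  open import Relation.Binary.Reasoning.Setoid setoid

  -- Also the total weight of the lattice paths that start at height `l` and first reach height 0 at
  -- step `N`, where down, level and up steps weigh 1, `b` and `t`.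
  W : ℕ → ℕ → Carrier
  W zero    zero    = 1#
  W zero    (suc N) = 0#
  W (suc l) zero    = 0#
  W (suc l) (suc N) = W l N + b * W (suc l) N + t * W (suc (suc l)) N

  W-zero : ∀ l N → N < l → W l N ≈ 0#
  W-zero (suc l) zero    _         = refl
  W-zero (suc l) (suc N) (s≤s N<l) = begin
    W l N + b * W (suc l) N + t * W (suc (suc l)) N
      ≈⟨ +-cong (+-cong (W-zero l N N<l) (*-congˡ (W-zero (suc l) N (ℕₚ.m≤n⇒m≤1+n N<l))))
                (*-congˡ (W-zero (suc (suc l)) N (ℕₚ.m≤n⇒m≤1+n (ℕₚ.m≤n⇒m≤1+n N<l)))) ⟩
    0# + b * 0# + t * 0#
      ≈⟨ solve 2 (λ b t → con 0 :+ b :* con 0 :+ t :* con 0 := con 0) refl b t ⟩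
    0# ∎

  W-diagonal : ∀ N → W N N ≈ 1#
  W-diagonal zero    = refl
  W-diagonal (suc N) = begin
    W N N + b * W (suc N) N + t * W (suc (suc N)) N
      ≈⟨ +-cong (+-cong (W-diagonal N) (*-congˡ (W-zero (suc N) N ℕₚ.≤-refl)))
                (*-congˡ (W-zero (suc (suc N)) N (ℕₚ.n≤1+n _))) ⟩
    1# + b * 0# + t * 0#
      ≈⟨ solve 2 (λ b t → con 1 :+ b :* con 0 :+ t :* con 0 := con 1) refl b t ⟩
    1# ∎

  Σ≤ : ℕ → (ℕ → Carrier) → Carrier
  Σ≤ zero    f = f 0
  Σ≤ (suc n) f = Σ≤ n f + f (suc n)

  Σ≤-cong : ∀ n {f g} → (∀ i → i ≤ n → f i ≈ g i) → Σ≤ n f ≈ Σ≤ n g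
  Σ≤-cong zero    eq = eq 0 z≤n
  Σ≤-cong (suc n) eq =
    +-cong (Σ≤-cong n λ i i≤n → eq i (ℕₚ.m≤n⇒m≤1+n i≤n)) (eq (suc n) ℕₚ.≤-refl)

  Σ≤-zero : ∀ n {f} → (∀ i → i ≤ n → f i ≈ 0#) → Σ≤ n f ≈ 0#
  Σ≤-zero zero    eq = eq 0 z≤n
  Σ≤-zero (suc n) eq = trans
    (+-cong (Σ≤-zero n λ i i≤n → eq i (ℕₚ.m≤n⇒m≤1+n i≤n)) (eq (suc n) ℕₚ.≤-refl)) (+-identityˡ 0#)

  Σ≤-head : ∀ n f → Σ≤ (suc n) f ≈ f 0 + Σ≤ n (f ∘ suc)
  Σ≤-head zero    f = refl
  Σ≤-head (suc n) f = trans (+-congʳ (Σ≤-head n f)) (+-assoc _ _ _)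

  Σ≤-truncate : ∀ k n {f} → (∀ i → n < i → i ≤ k ℕ.+ n → f i ≈ 0#) → Σ≤ (k ℕ.+ n) f ≈ Σ≤ n f
  Σ≤-truncate zero    n eq = refl
  Σ≤-truncate (suc k) n eq = trans
    (+-cong (Σ≤-truncate k n λ i n<i i≤k+n → eq i n<i (ℕₚ.m≤n⇒m≤1+n i≤k+n))
            (eq (suc k ℕ.+ n) (s≤s (ℕₚ.m≤n+m n k)) ℕₚ.≤-refl))
    (+-identityʳ _)

  Σ≤-recurrence : ∀ n (f g h k : ℕ → Carrier) → Σ≤ n (λ i → f i * (g i + b * h i + t * k i)) ≈
    Σ≤ n (λ i → f i * g i) + b * Σ≤ n (λ i → f i * h i) + t * Σ≤ n (λ i → f i * k i)
  Σ≤-recurrence zero    f g h k = solve 6 (λ b t f g h k →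
    f :* (g :+ b :* h :+ t :* k) := f :* g :+ b :* (f :* h) :+ t :* (f :* k)) refl b t _ _ _ _
  Σ≤-recurrence (suc n) f g h k = trans (+-congʳ (Σ≤-recurrence n f g h k))
    (solve 9 (λ b t f g h k x y z →
      x :+ b :* y :+ t :* z :+ f :* (g :+ b :* h :+ t :* k) :=
      (x :+ f :* g) :+ b :* (y :+ f :* h) :+ t :* (z :+ f :* k)) refl b t _ _ _ _ _ _ _)

  -- The coefficient form of w · w^l = w^(l+1). The recurrence is applied to the second factor; by
  -- induction on `N` the three resulting sums are the three terms of the recurrence for the
  -- product.
  W-convolution : ∀ l N → Σ≤ N (λ i → W 1 i * W l (N ∸ i)) ≈ W (suc l) N
  W-convolution l       zero    = zeroˡ _
  W-convolution zero    (suc N) = begin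
    Σ≤ N (λ i → W 1 i * W 0 (suc N ∸ i)) + W 1 (suc N) * W 0 (N ∸ N)
      ≈⟨ +-cong (Σ≤-zero N λ i i≤N → trans
           (*-congˡ (reflexive (≡.cong (W 0) (ℕₚ.+-∸-assoc 1 i≤N)))) (zeroʳ _))
           (*-congˡ (reflexive (≡.cong (W 0) (ℕₚ.n∸n≡0 N)))) ⟩
    0# + W 1 (suc N) * 1# ≈⟨ solve 1 (λ x → con 0 :+ x :* con 1 := x) refl _ ⟩
    W 1 (suc N) ∎
  W-convolution (suc l) (suc N) = begin
    Σ≤ N (λ i → W 1 i * W (suc l) (suc N ∸ i)) + W 1 (suc N) * W (suc l) (N ∸ N)
      ≈⟨ +-cong (Σ≤-cong N λ i i≤N → *-congˡ (reflexive (≡.cong (W (suc l)) (ℕₚ.+-∸-assoc 1 i≤N))))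
           (trans (*-congˡ (reflexive (≡.cong (W (suc l)) (ℕₚ.n∸n≡0 N)))) (zeroʳ _)) ⟩
    Σ≤ N (λ i → W 1 i * W (suc l) (suc (N ∸ i))) + 0# ≈⟨ +-identityʳ _ ⟩
    Σ≤ N (λ i → W 1 i * W (suc l) (suc (N ∸ i)))
      ≈⟨ Σ≤-recurrence N (W 1) (λ i → W l (N ∸ i)) (λ i → W (suc l) (N ∸ i)) (λ i → W (2 ℕ.+ l) (N ∸ i)) ⟩
    Σ≤ N (λ i → W 1 i * W l (N ∸ i)) + b * Σ≤ N (λ i → W 1 i * W (suc l) (N ∸ i))
      + t * Σ≤ N (λ i → W 1 i * W (2 ℕ.+ l) (N ∸ i))
      ≈⟨ +-cong (+-cong (W-convolution l N) (*-congˡ (W-convolution (suc l) N)))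
                (*-congˡ (W-convolution (2 ℕ.+ l) N)) ⟩
    W (2 ℕ.+ l) (suc N) ∎

  -- Here the powers of q are divided out: w has no constant term and w^l starts at q^l, so the
  -- first summand of the convolution and, after reindexing, those with `i > n` vanish.
  W-power : ∀ l n → W (suc l) (suc l ℕ.+ n) ≈ Σ≤ n (λ i → W 1 (suc i) * W l (l ℕ.+ (n ∸ i)))
  W-power l n = begin
    W (suc l) (suc (l ℕ.+ n)) ≈⟨ W-convolution l (suc (l ℕ.+ n)) ⟨
    Σ≤ (suc (l ℕ.+ n)) (λ i → W 1 i * W l (suc (l ℕ.+ n) ∸ i)) ≈⟨ Σ≤-head (l ℕ.+ n) _ ⟩
    0# * W l (suc (l ℕ.+ n)) + Σ≤ (l ℕ.+ n) (λ i → W 1 (suc i) * W l (l ℕ.+ n ∸ i))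
      ≈⟨ trans (+-congʳ (zeroˡ _)) (+-identityˡ _) ⟩
    Σ≤ (l ℕ.+ n) (λ i → W 1 (suc i) * W l (l ℕ.+ n ∸ i))
      ≈⟨ Σ≤-truncate l n (λ i n<i i≤ → trans (*-congˡ (W-zero l _ (short n<i i≤))) (zeroʳ _)) ⟩
    Σ≤ n (λ i → W 1 (suc i) * W l (l ℕ.+ n ∸ i))
      ≈⟨ Σ≤-cong n (λ i i≤n → *-congˡ (reflexive (≡.cong (W l) (ℕₚ.+-∸-assoc l i≤n)))) ⟩
    Σ≤ n (λ i → W 1 (suc i) * W l (l ℕ.+ (n ∸ i))) ∎
    where
    short : ∀ {i} → n < i → i ≤ l ℕ.+ n → l ℕ.+ n ∸ i < l
    short {i} n<i i≤ = ℕₚ.+-cancelʳ-< i _ _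
      (≡.subst (_< l ℕ.+ i) (≡.sym (ℕₚ.m∸n+n≡m i≤)) (ℕₚ.+-monoʳ-< l n<i))

  -- Chebyshev sums of powers of w and their shift

  -- Rows start at the coefficient of q^1, which makes `F 0` the zero column; `previous` starts from
  -- this.
  F : ℕ → Column
  F l i = W l (suc i)

  -- U_r of the Jacobi operator, applied to F (l + r)
  H : ℕ → ℕ → Column
  H l zero    i = F l i
  H l (suc r) i = F l i + t * H (2 ℕ.+ l) r i

  H-zero : ∀ l r i → suc i < l → H l r i ≈ 0#
  H-zero l zero    i lt = W-zero l (suc i) lt
  H-zero l (suc r) i lt = begin
    F l i + t * H (2 ℕ.+ l) r i
      ≈⟨ +-cong (W-zero l (suc i) lt)
                (*-congˡ (H-zero (2 ℕ.+ l) r i (ℕₚ.m≤n⇒m≤1+n (ℕₚ.m≤n⇒m≤1+n lt)))) ⟩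
    0# + t * 0# ≈⟨ solve 1 (λ t → con 0 :+ t :* con 0 := con 0) refl t ⟩
    0# ∎

  H-one : ∀ l r i → suc i ≡ l → H l r i ≈ 1#
  H-one _ zero    i ≡.refl = W-diagonal (suc i)
  H-one _ (suc r) i ≡.refl = begin
    F (suc i) i + t * H (3 ℕ.+ i) r i
      ≈⟨ +-cong (W-diagonal (suc i)) (*-congˡ (H-zero (3 ℕ.+ i) r i (ℕₚ.n≤1+n _))) ⟩
    1# + t * 0# ≈⟨ solve 1 (λ t → con 1 :+ t :* con 0 := con 1) refl t ⟩
    1# ∎

  -- `U_r` commutes with the Jacobi operator, so `H` inherits the recurrence of `F` for each fixed
  -- `r`.
  H-shift : ∀ l r i → H (suc l) r (suc i) ≈ H l r i + b * H (suc l) r i + t * H (2 ℕ.+ l) r i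
  H-shift l zero    i = refl
  H-shift l (suc r) i = begin
    F (suc l) (suc i) + t * H (3 ℕ.+ l) r (suc i)
      ≈⟨ +-congˡ (*-congˡ (H-shift (2 ℕ.+ l) r i)) ⟩
    (F l i + b * F (suc l) i + t * F (2 ℕ.+ l) i) +
      t * (H (2 ℕ.+ l) r i + b * H (3 ℕ.+ l) r i + t * H (4 ℕ.+ l) r i)
      ≈⟨ solve 8 (λ x b y t z p q s →
           (x :+ b :* y :+ t :* z) :+ t :* (p :+ b :* q :+ t :* s) :=
           x :+ t :* p :+ b :* (y :+ t :* q) :+ t :* (z :+ t :* s)) refl _ _ _ _ _ _ _ _ ⟩
    H l (suc r) i + b * H (suc l) (suc r) i + t * H (2 ℕ.+ l) (suc r) i ∎

  -- `H` is defined by splitting off the lowest power of w. Here the highest one is split off, which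
  -- at the end of a block becomes the head of the next block.
  H-top : ∀ r {l k} i → suc r ℕ.+ suc r ℕ.+ l ≡ k → H l (suc r) i ≈ H l r i + t ^ suc r * F k i
  H-top zero    i ≡.refl = +-congˡ (*-congʳ (sym (*-identityʳ t)))
  H-top (suc r) {l} {k} i eq = begin
    F l i + t * H (2 ℕ.+ l) (suc r) i ≈⟨ +-congˡ (*-congˡ (H-top r i (≡.trans (lemma r l) eq))) ⟩
    F l i + t * (H (2 ℕ.+ l) r i + t ^ suc r * F k i)
      ≈⟨ solve 5 (λ f t h p g → f :+ t :* (h :+ p :* g) := f :+ t :* h :+ t :* p :* g)
           refl _ _ _ _ _ ⟩
    H l (suc r) i + t ^ suc (suc r) * F k i ∎
    where
    lemma : ∀ r l → suc r ℕ.+ suc r ℕ.+ (2 ℕ.+ l) ≡ suc (suc r) ℕ.+ suc (suc r) ℕ.+ l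
    lemma = ℕ-Solver.solve-∀

  -- Multiplication by x takes column `k` to column `suc k`, hence raises the degree of a monic
  -- combination by one; `d` collects the lower terms that are then subtracted.
  leads-step : ∀ {v j x y d} → (∀ k i → v k (suc i) ≈ v (suc k) i) →
               Leads v j x → Span v (suc j) d → (∀ i → x (suc i) ≈ y i + d i) → Leads v (suc j) y
  leads-step {v} {j} {x} {y} {d} shift (z , Z , x≈) D eq =
    (λ i → z (suc i) + ε * d i) , combine ε (span-shift Z) D (λ i → refl) , λ i → begin
      y i                              ≈⟨ +-identityʳ (y i) ⟨
      y i + 0#                         ≈⟨ +-congˡ (x+εx≈0 (d i)) ⟨
      y i + (d i + ε * d i)            ≈⟨ +-assoc _ _ _ ⟨
      y i + d i + ε * d i              ≈⟨ +-congʳ (trans (sym (eq i)) (x≈ (suc i))) ⟩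
      v j (suc i) + z (suc i) + ε * d i ≈⟨ +-assoc _ _ _ ⟩
      v j (suc i) + (z (suc i) + ε * d i) ≈⟨ +-congʳ (shift j i) ⟩
      v (suc j) i + (z (suc i) + ε * d i) ∎
    where
    span-shift : ∀ {x} → Span v j x → Span v (suc j) (x ∘ suc)
    span-shift (none eq)          = none (eq ∘ suc)
    span-shift (column k k<j eq)  = column (suc k) (s≤s k<j) λ i → trans (eq (suc i)) (shift k i)
    span-shift (combine s x y eq) = combine s (span-shift x) (span-shift y) (eq ∘ suc)

  -- The unitriangular change of the Hankel columns

  module _ (μ : ℕ) where

    m : ℕ
    m = suc μ

    hankel : ℕ → Column
    hankel j i = F m (j ℕ.+ i)

    hankel-shift : ∀ k i → hankel k (suc i) ≈ hankel (suc k) i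
    hankel-shift k i = reflexive (≡.cong (F m) (ℕₚ.+-suc k i))

    Y : ℕ → ℕ → Column
    Y β r i = t ^ (β ℕ.* m) * H ((m ∸ r) ℕ.+ β ℕ.* m) r i

    Y-at : ∀ β r {k} → m ∸ r ≡ k → ∀ i →
           Y β r i ≈ t ^ (β ℕ.* m) * H (k ℕ.+ β ℕ.* m) r i
    Y-at β r eq i = reflexive (≡.cong (λ k → t ^ (β ℕ.* m) * H (k ℕ.+ β ℕ.* m) r i) eq)

    Y-shift : ∀ β r {k} → m ∸ r ≡ suc k → ∀ i → let l = k ℕ.+ β ℕ.* m in
      Y β r (suc i) ≈ t ^ (β ℕ.* m) * (H l r i + b * H (suc l) r i + t * H (2 ℕ.+ l) r i)
    Y-shift β r eq i = trans (Y-at β r eq (suc i)) (*-congˡ (H-shift _ r i))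

    twice : ℕ → ℕ → Column
    twice l zero    i = 0#
    twice l (suc r) i = (t + t) * H (2 ℕ.+ l) r i

    -- The operator 1/w + t w acting on a sum of powers: the two copies overlap in all but the
    -- lowest power of the first and the highest power of the second, so the interior is doubled.
    H-twice : ∀ l r {k} i → suc r ℕ.+ suc r ℕ.+ l ≡ k →
              H l r i + t * H (2 ℕ.+ l) r i ≈ t ^ suc r * F k i + (F l i + twice l r i)
    H-twice l zero    {k} i ≡.refl =
      solve 3 (λ f t g → f :+ t :* g := t :* con 1 :* g :+ (f :+ con 0)) refl _ _ _
    H-twice l (suc r) {k} i eq = begin
      F l i + t * H (2 ℕ.+ l) r i + t * H (2 ℕ.+ l) (suc r) i
        ≈⟨ +-congˡ (*-congˡ (H-top r i (≡.trans (index r l) eq))) ⟩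
      F l i + t * H (2 ℕ.+ l) r i + t * (H (2 ℕ.+ l) r i + t ^ suc r * F k i)
        ≈⟨ solve 5 (λ f t h p g → f :+ t :* h :+ t :* (h :+ p :* g)
                               := t :* p :* g :+ (f :+ (t :+ t) :* h)) refl _ _ _ _ _ ⟩
      t ^ suc (suc r) * F k i + (F l i + twice l (suc r) i) ∎
      where
      index : ∀ r l → suc r ℕ.+ suc r ℕ.+ (2 ℕ.+ l) ≡ suc (suc r) ℕ.+ suc (suc r) ℕ.+ l
      index = ℕ-Solver.solve-∀

    -- Inside a block, U_(r+2) = (x - b) U_(r+1) - t U_r yields the next column. From the last
    -- column of a block, `H-twice` yields the head of the next one; what is split off consists of
    -- multiples of `Y β μ` and `Y β (μ - 1)` and of the lowest power, which `previous` handles.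
    leads : ∀ β r → r < m → Leads hankel (r ℕ.+ β ℕ.* m) (Y β r)
    -- The lowest power is zero for the initial block, and otherwise `t ^ m` times the head of the
    -- preceding block.
    previous : ∀ β → Span hankel (m ℕ.+ β ℕ.* m) (λ i → t ^ (β ℕ.* m) * F (β ℕ.* m) i)

    previous zero    = none λ i → zeroʳ _
    previous (suc β) = span-scale (t ^ m) (span-weaken (s≤s (ℕₚ.≤-trans (ℕₚ.m≤n+m (β ℕ.* m) m) (ℕₚ.m≤n+m _ μ)))
      (leads⇒span (leads β 0 (s≤s z≤n)))) λ i →
        trans (*-congʳ (^-homo-* t m (β ℕ.* m))) (*-assoc _ _ _)

    leads zero    zero _ = (λ _ → 0#) , none (λ i → refl) , λ i →
      trans (*-identityˡ _) (trans (reflexive (≡.cong (λ k → F k i) (ℕₚ.+-identityʳ m))) (sym (+-identityʳ _)))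
    leads (suc β) zero _ =
      leads-step hankel-shift (leads β μ ℕₚ.≤-refl)
        (combine b (combine 1# (previous β) (middle μ ≡.refl) λ i → refl)
          (leads⇒span (leads β μ ℕₚ.≤-refl)) λ i → refl)
        λ i → begin
          Y β μ (suc i) ≈⟨ Y-shift β μ 1≡ i ⟩
          P * (H l μ i + b * H (suc l) μ i + t * H (2 ℕ.+ l) μ i)
            ≈⟨ solve 5 (λ p x b y z → p :* (x :+ b :* y :+ z)
                                   := p :* (x :+ z) :+ b :* (p :* y)) refl _ _ _ _ _ ⟩
          P * (H l μ i + t * H (2 ℕ.+ l) μ i) + b * (P * H (suc l) μ i)
            ≈⟨ +-cong (*-congˡ (H-twice l μ i (index μ l))) (*-congˡ (sym (Y-at β μ 1≡ i))) ⟩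
          P * (t ^ m * F (m ℕ.+ (m ℕ.+ l)) i + (F l i + twice l μ i)) + b * Y β μ i
            ≈⟨ solve 6 (λ p q f g h y → p :* (q :* f :+ (g :+ h)) :+ y
                                     := q :* p :* f :+ (p :* g :+ con 1 :* (p :* h) :+ y))
                 refl _ _ _ _ _ _ ⟩
          t ^ m * P * F (m ℕ.+ (m ℕ.+ l)) i + (P * F l i + 1# * (P * twice l μ i) + b * Y β μ i)
            ≈⟨ +-congʳ (*-congʳ (^-homo-* t m l)) ⟨
          Y (suc β) 0 i + (P * F l i + 1# * (P * twice l μ i) + b * Y β μ i) ∎
      where
      l = β ℕ.* m
      P = t ^ l
      1≡ : m ∸ μ ≡ 1
      1≡ = ℕₚ.m+n∸n≡m 1 μ
      index : ∀ μ l → suc μ ℕ.+ suc μ ℕ.+ l ≡ suc μ ℕ.+ (suc μ ℕ.+ l)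
      index = ℕ-Solver.solve-∀
      -- `r` is kept apart from `μ` so that it can be matched on: for `μ = 0` there are no interior
      -- terms.
      middle : ∀ r → r ≡ μ → Span hankel (m ℕ.+ l) (λ i → P * twice l r i)
      middle zero    _  = none λ i → zeroʳ _
      middle (suc r) eq = span-scale (t + t)
        (span-weaken (ℕₚ.+-monoˡ-≤ l (ℕₚ.m≤n⇒m≤1+n (ℕₚ.≤-reflexive eq))) (leads⇒span (leads β r r<m)))
        λ i → trans (solve 3 (λ p s h → p :* (s :* h) := s :* (p :* h)) refl _ _ _)
                    (*-congˡ (sym (Y-at β r 2≡ i)))
        where
        r<m : r < m
        r<m = ℕₚ.m≤n⇒m≤1+n (ℕₚ.≤-reflexive eq)
        2≡ : m ∸ r ≡ 2
        2≡ = ≡.trans (≡.cong (λ k → suc k ∸ r) (≡.sym eq)) (ℕₚ.m+n∸n≡m 2 r)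
    leads β (suc zero) 1<m =
      let L = leads β 0 (ℕₚ.<-trans (s≤s z≤n) 1<m) in
      leads-step hankel-shift L (span-scale b (leads⇒span L) λ i → refl)
      λ i → trans (Y-shift β 0 ≡.refl i) (solve 6 (λ p x b y t z →
        p :* (x :+ b :* y :+ t :* z) := p :* (x :+ t :* z) :+ b :* (p :* y)) refl _ _ _ _ _ _)
    leads β (suc (suc r)) (s≤s 1+r<μ) =
      let L = leads β (suc r) (s≤s r<μ) in
      leads-step hankel-shift L
        (combine t (span-scale b (leads⇒span L) λ i → refl)
          (span-weaken (ℕₚ.n≤1+n _) (leads⇒span (leads β r r<m))) λ i → refl)
        λ i → begin
          Y β (suc r) (suc i) ≈⟨ Y-shift β (suc r) 1+k i ⟩
          P * (F l i + t * H (2 ℕ.+ l) r i + b * H (suc l) (suc r) i + t * H (2 ℕ.+ l) (suc r) i)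
            ≈⟨ solve 7 (λ p f t h b y z → p :* (f :+ t :* h :+ b :* y :+ t :* z)
                 := p :* (f :+ t :* z) :+ (b :* (p :* y) :+ t :* (p :* h))) refl _ _ _ _ _ _ _ ⟩
          P * H l (2 ℕ.+ r) i + (b * (P * H (suc l) (suc r) i) + t * (P * H (2 ℕ.+ l) r i))
            ≈⟨ +-congˡ (+-cong (*-congˡ (Y-at β (suc r) 1+k i)) (*-congˡ (Y-at β r 2+k i))) ⟨
          Y β (2 ℕ.+ r) i + (b * Y β (suc r) i + t * Y β r i) ∎
      where
      r<μ : r < μ
      r<μ = ℕₚ.<⇒≤ 1+r<μ
      k = μ ∸ suc r
      l = k ℕ.+ β ℕ.* m
      P = t ^ (β ℕ.* m)
      1+k : μ ∸ r ≡ suc k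
      1+k = ℕₚ.+-∸-assoc 1 r<μ
      2+k : suc μ ∸ r ≡ suc (suc k)
      2+k = ≡.trans (ℕₚ.+-∸-assoc 1 (ℕₚ.<⇒≤ r<μ)) (≡.cong suc 1+k)
      r<m : r < m
      r<m = ℕₚ.m≤n⇒m≤1+n r<μ

    Y-zero : ∀ β r i → r < m → suc (r ℕ.+ i) < m ℕ.+ β ℕ.* m → Y β r i ≈ 0#
    Y-zero β r i r<m lt = trans (*-congˡ (H-zero _ r i lemma)) (zeroʳ _)
      where
      lemma : suc i < (m ∸ r) ℕ.+ β ℕ.* m
      lemma = ℕₚ.+-cancelˡ-< r _ _ (≡.subst₂ _<_ (≡.sym (ℕₚ.+-suc r i)) (≡.trans
        (≡.cong (ℕ._+ β ℕ.* m) (≡.sym (ℕₚ.m+[n∸m]≡n (ℕₚ.<⇒≤ r<m)))) (ℕₚ.+-assoc r _ _)) lt)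

    Y-corner : ∀ β r i → r < m → suc (r ℕ.+ i) ≡ m ℕ.+ β ℕ.* m → Y β r i ≈ t ^ (β ℕ.* m)
    Y-corner β r i r<m eq = trans (*-congˡ (H-one _ r i lemma)) (*-identityʳ _)
      where
      lemma : suc i ≡ (m ∸ r) ℕ.+ β ℕ.* m
      lemma = ℕₚ.+-cancelˡ-≡ r _ _ (≡.trans (ℕₚ.+-suc r i) (≡.trans eq (≡.trans
        (≡.cong (ℕ._+ β ℕ.* m) (≡.sym (ℕₚ.m+[n∸m]≡n (ℕₚ.<⇒≤ r<m)))) (ℕₚ.+-assoc r _ _))))

    -- Block triangular form and evaluation

    y : ℕ → Column
    y j = Y (j / m) (j % m)

    y-leads : ∀ j → Leads hankel j (y j)
    y-leads j = ≡.subst (λ k → Leads hankel k (y j)) (≡.sym (m≡m%n+[m/n]*n j m))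
                  (leads (j / m) (j % m) (m%n<n j m))

    y-block : ∀ β r → r < m → y (r ℕ.+ β ℕ.* m) ≡ Y β r
    y-block β r r<m = ≡.cong₂ Y
      (≡.trans (+-distrib-/-∣ʳ r (n∣m*n β)) (≡.cong₂ ℕ._+_ (m<n⇒m/n≡0 r<m) (m*n/n≡m β m)))
      (≡.trans ([m+kn]%n≡m%n r β m) (m<n⇒m%n≡m r<m))

    -- Column `j` vanishes above row `(j / m) * m`, and `j` lies in a block later than `β`.
    y-right : ∀ j i β → suc β ℕ.* m ≤ j → i < suc β ℕ.* m → y j i ≈ 0#
    y-right j i β le lt = Y-zero (j / m) (j % m) i (m%n<n j m)
      (≡.subst (_< m ℕ.+ (j / m) ℕ.* m) (ℕₚ.+-suc (j % m) i)
        (ℕₚ.+-mono-<-≤ (m%n<n j m) (ℕₚ.≤-trans lt (ℕₚ.*-monoˡ-≤ m 1+β≤j/m))))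
      where
      1+β≤j/m : suc β ≤ j / m
      1+β≤j/m = ≡.subst (_≤ j / m) (m*n/n≡m (suc β) m) (/-monoˡ-≤ m le)

    corner : ℕ → ℕ → Column
    corner β j i = y (j ℕ.+ β ℕ.* m) (i ℕ.+ β ℕ.* m)

    corner-block : ∀ β j → j < m → ∀ i → corner β j i ≡ Y β j (i ℕ.+ β ℕ.* m)
    corner-block β j j<m i = ≡.cong (λ x → x (i ℕ.+ β ℕ.* m)) (y-block β j j<m)

    corner-step : ∀ β n → detℕ (m ℕ.+ n) (corner β) ≈
      ε ^ triangle m * ((t ^ (β ℕ.* m)) ^ m * detℕ n (corner (suc β)))
    corner-step β n = trans (detℕ-antitriangular m n above diagonal right)
      (*-congˡ (*-congˡ (detℕ-cong n λ j _ i → reflexive (≡.cong₂ y (index j) (index i)))))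
      where
      index : ∀ k → m ℕ.+ k ℕ.+ β ℕ.* m ≡ k ℕ.+ suc β ℕ.* m
      index k = ≡.trans (≡.cong (ℕ._+ β ℕ.* m) (ℕₚ.+-comm m k)) (ℕₚ.+-assoc k m _)
      below : ∀ {k i} → suc (k ℕ.+ i) ≤ m → k < m
      below le = ℕₚ.≤-trans (s≤s (ℕₚ.m≤m+n _ _)) le
      above : ∀ k i → suc (k ℕ.+ i) < m → corner β k i ≈ 0#
      above k i lt = trans (reflexive (corner-block β k k<m i)) (Y-zero β k _ k<m
        (≡.subst (_< m ℕ.+ β ℕ.* m) (≡.cong suc (ℕₚ.+-assoc k i _)) (ℕₚ.+-monoˡ-< (β ℕ.* m) lt)))
        where
        k<m : k < m
        k<m = below (ℕₚ.<⇒≤ lt)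
      diagonal : ∀ k i → suc (k ℕ.+ i) ≡ m → corner β k i ≈ t ^ (β ℕ.* m)
      diagonal k i eq = trans (reflexive (corner-block β k k<m i)) (Y-corner β k _ k<m
        (≡.trans (≡.cong suc (≡.sym (ℕₚ.+-assoc k i _))) (≡.cong (ℕ._+ β ℕ.* m) eq)))
        where
        k<m : k < m
        k<m = below (ℕₚ.≤-reflexive eq)
      right : ∀ k i → m ≤ k → i < m → corner β k i ≈ 0#
      right k i m≤k i<m = y-right _ _ β (ℕₚ.+-monoˡ-≤ (β ℕ.* m) m≤k) (ℕₚ.+-monoˡ-< (β ℕ.* m) i<m)

    -- Block `β` contributes the m-th power of t^(βm), and `n * β + triangle n` is β + (β + 1) + ...
    -- + (β + n - 1). The starting block is arbitrary because each step removes the leading one. The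
    -- remainder `s` lets both cases of the theorem share the induction.
    corner-blocks : ∀ n β s → detℕ (n ℕ.* m ℕ.+ s) (corner β) ≈
      ε ^ (n ℕ.* triangle m) * (t ^ ((n ℕ.* β ℕ.+ triangle n) ℕ.* (m ℕ.* m)) * detℕ s (corner (n ℕ.+ β)))
    corner-blocks zero    β s = sym (trans (*-identityˡ _) (*-identityˡ _))
    corner-blocks (suc n) β s = begin
      detℕ (m ℕ.+ n ℕ.* m ℕ.+ s) (corner β)
        ≈⟨ reflexive (≡.cong (λ k → detℕ k (corner β)) (ℕₚ.+-assoc m (n ℕ.* m) s)) ⟩
      detℕ (m ℕ.+ (n ℕ.* m ℕ.+ s)) (corner β)
        ≈⟨ corner-step β (n ℕ.* m ℕ.+ s) ⟩
      ε ^ triangle m * ((t ^ (β ℕ.* m)) ^ m * detℕ (n ℕ.* m ℕ.+ s) (corner (suc β)))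
        ≈⟨ *-congˡ (*-cong (^-assocʳ t (β ℕ.* m) m) (corner-blocks n (suc β) s)) ⟩
      ε ^ triangle m * (t ^ (β ℕ.* m ℕ.* m) * (ε ^ (n ℕ.* triangle m) *
        (t ^ ((n ℕ.* suc β ℕ.+ triangle n) ℕ.* (m ℕ.* m)) * detℕ s (corner (n ℕ.+ suc β)))))
        ≈⟨ solve 5 (λ a p b q d → a :* (p :* (b :* (q :* d))) := a :* b :* (p :* q :* d))
             refl _ _ _ _ _ ⟩
      ε ^ triangle m * ε ^ (n ℕ.* triangle m) * (t ^ (β ℕ.* m ℕ.* m) *
        t ^ ((n ℕ.* suc β ℕ.+ triangle n) ℕ.* (m ℕ.* m)) * detℕ s (corner (n ℕ.+ suc β)))
        ≈⟨ *-cong (^-homo-* ε (triangle m) (n ℕ.* triangle m)) (*-cong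
             (trans (^-congʳ t (≡.sym (exponent n β (triangle n) m))) (^-homo-* t (β ℕ.* m ℕ.* m) _))
             (reflexive (≡.cong (λ k → detℕ s (corner k)) (≡.sym (ℕₚ.+-suc n β))))) ⟨
      ε ^ (suc n ℕ.* triangle m) * (t ^ ((suc n ℕ.* β ℕ.+ triangle (suc n)) ℕ.* (m ℕ.* m)) *
        detℕ s (corner (suc n ℕ.+ β))) ∎
      where
      exponent : ∀ n β τ m → β ℕ.* m ℕ.* m ℕ.+ (n ℕ.* suc β ℕ.+ τ) ℕ.* (m ℕ.* m) ≡
                             (suc n ℕ.* β ℕ.+ (n ℕ.+ τ)) ℕ.* (m ℕ.* m)
      exponent = ℕ-Solver.solve-∀

    hankel-corner : ∀ N → detℕ N hankel ≈ detℕ N (corner 0)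
    hankel-corner N = trans (sym (detℕ-unitriangular N λ j _ → y-leads j))
      (detℕ-cong N λ j _ i → reflexive (≡.cong₂ y (≡.sym (ℕₚ.+-identityʳ j)) (≡.sym (ℕₚ.+-identityʳ i))))

    detℕ-hankel : ∀ n → detℕ (n ℕ.* m) hankel ≈
      ε ^ (n ℕ.* triangle m) * t ^ (triangle n ℕ.* (m ℕ.* m))
    detℕ-hankel n = begin
      detℕ (n ℕ.* m) hankel              ≈⟨ hankel-corner (n ℕ.* m) ⟩
      detℕ (n ℕ.* m) (corner 0)
        ≈⟨ reflexive (≡.cong (λ k → detℕ k (corner 0)) (≡.sym (ℕₚ.+-identityʳ (n ℕ.* m)))) ⟩
      detℕ (n ℕ.* m ℕ.+ 0) (corner 0)    ≈⟨ corner-blocks n 0 0 ⟩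
      ε ^ (n ℕ.* triangle m) * (t ^ ((n ℕ.* 0 ℕ.+ triangle n) ℕ.* (m ℕ.* m)) * 1#)
        ≈⟨ *-congˡ (*-identityʳ _) ⟩
      ε ^ (n ℕ.* triangle m) * t ^ ((n ℕ.* 0 ℕ.+ triangle n) ℕ.* (m ℕ.* m))
        ≈⟨ *-congˡ (^-congʳ t (≡.cong (λ k → (k ℕ.+ triangle n) ℕ.* (m ℕ.* m)) (ℕₚ.*-zeroʳ n))) ⟩
      ε ^ (n ℕ.* triangle m) * t ^ (triangle n ℕ.* (m ℕ.* m)) ∎

    detℕ-hankel-zero : ∀ n s → suc s < m → detℕ (n ℕ.* m ℕ.+ suc s) hankel ≈ 0#
    detℕ-hankel-zero n s s<m = begin
      detℕ (n ℕ.* m ℕ.+ suc s) hankel ≈⟨ trans (hankel-corner (n ℕ.* m ℕ.+ suc s)) (corner-blocks n 0 (suc s)) ⟩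
      _ * (_ * detℕ (suc s) (corner (n ℕ.+ 0)))
        ≈⟨ *-congˡ (*-congˡ (detℕ-zero-row s {corner (n ℕ.+ 0)} zero-row)) ⟩
      _ * (_ * 0#) ≈⟨ trans (*-congˡ (zeroʳ _)) (zeroʳ _) ⟩
      0# ∎
      where
      -- In its first row a diagonal block can be nonzero only in its last column, which is cut off
      -- because `suc s < m`.
      zero-row : ∀ j → j < suc s → corner (n ℕ.+ 0) j 0 ≈ 0#
      zero-row j (s≤s j≤s) = trans (reflexive (corner-block β j j<m 0)) (Y-zero β j _ j<m
        (ℕₚ.+-monoˡ-< (β ℕ.* m) (ℕₚ.≤-<-trans (s≤s j≤s) s<m)))
        where
        β = n ℕ.+ 0
        j<m : j < m
        j<m = ℕₚ.<-trans (s≤s j≤s) s<m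

-- The commutative ring of coefficient sequences in t

open import Data.Fin using (Fin; zero; suc; toℕ; punchIn)
open import Data.Nat using (_*_)

sumTo-cong : ∀ n {f g} → (∀ i → i ≤ n → f i ≡ g i) → sumTo n f ≡ sumTo n g
sumTo-cong zero    eq = eq 0 z≤n
sumTo-cong (suc n) eq =
  ≡.cong₂ ℤ._+_ (sumTo-cong n λ i i≤n → eq i (ℕₚ.m≤n⇒m≤1+n i≤n)) (eq (suc n) ℕₚ.≤-refl)

sumTo-head : ∀ n f → sumTo (suc n) f ≡ f 0 ℤ.+ sumTo n (f ∘ suc)
sumTo-head zero    f = ≡.refl
sumTo-head (suc n) f = ≡.trans (≡.cong (λ z → z ℤ.+ f (2 ℕ.+ n)) (sumTo-head n f)) (ℤₚ.+-assoc (f 0) _ _)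

-- Splitting off the constant term of the left factor makes the Cauchy product a structural
-- recursion, so the ring laws below need no exchange of double sums.
*ₚ-suc : ∀ p q k → (p *ₚ q) (suc k) ≡ p 0 ℤ.* q (suc k) ℤ.+ ((p ∘ suc) *ₚ q) k
*ₚ-suc p q k = sumTo-head k _

*ₚ-cong : ∀ {p q r s} → p ≈ₚ q → r ≈ₚ s → p *ₚ r ≈ₚ q *ₚ s
*ₚ-cong p≈q r≈s k = sumTo-cong k λ i _ → ≡.cong₂ ℤ._*_ (p≈q i) (r≈s (k ∸ i))

-- `*ₚ-suc` opens one sum at its head, and the definition of `sumTo` closes the other at its end;
-- the term moved is the same.
*ₚ-comm : ∀ p q → p *ₚ q ≈ₚ q *ₚ p
*ₚ-comm p q zero    = ℤₚ.*-comm (p 0) (q 0)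
*ₚ-comm p q (suc k) = begin
  (p *ₚ q) (suc k)                                 ≡⟨ *ₚ-suc p q k ⟩
  p 0 ℤ.* q (suc k) ℤ.+ ((p ∘ suc) *ₚ q) k         ≡⟨ ≡.cong₂ ℤ._+_ (ℤₚ.*-comm (p 0) _) (*ₚ-comm (p ∘ suc) q k) ⟩
  q (suc k) ℤ.* p 0 ℤ.+ (q *ₚ (p ∘ suc)) k         ≡⟨ ℤₚ.+-comm (q (suc k) ℤ.* p 0) _ ⟩
  (q *ₚ (p ∘ suc)) k ℤ.+ q (suc k) ℤ.* p 0
    ≡⟨ ≡.cong₂ ℤ._+_ (sumTo-cong k λ i i≤k → ≡.cong (λ j → q i ℤ.* p j) (≡.sym (ℕₚ.+-∸-assoc 1 i≤k)))
                     (≡.cong (λ j → q (suc k) ℤ.* p j) (≡.sym (ℕₚ.n∸n≡0 k))) ⟩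
  (q *ₚ p) (suc k)                                 ∎
  where open ≡.≡-Reasoning

*ₚ-distribʳ : ∀ r p q → (p +ₚ q) *ₚ r ≈ₚ (p *ₚ r) +ₚ (q *ₚ r)
*ₚ-distribʳ r p q zero    = ℤₚ.*-distribʳ-+ (r 0) (p 0) (q 0)
*ₚ-distribʳ r p q (suc k) = begin
  ((p +ₚ q) *ₚ r) (suc k) ≡⟨ *ₚ-suc (p +ₚ q) r k ⟩
  (p 0 ℤ.+ q 0) ℤ.* r (suc k) ℤ.+ (((p +ₚ q) ∘ suc) *ₚ r) k
    ≡⟨ ≡.cong (λ z → (p 0 ℤ.+ q 0) ℤ.* r (suc k) ℤ.+ z) (*ₚ-distribʳ r (p ∘ suc) (q ∘ suc) k) ⟩
  (p 0 ℤ.+ q 0) ℤ.* r (suc k) ℤ.+ (((p ∘ suc) *ₚ r) k ℤ.+ ((q ∘ suc) *ₚ r) k)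
    ≡⟨ rearrange (p 0) (q 0) (r (suc k)) _ _ ⟩
  p 0 ℤ.* r (suc k) ℤ.+ ((p ∘ suc) *ₚ r) k ℤ.+ (q 0 ℤ.* r (suc k) ℤ.+ ((q ∘ suc) *ₚ r) k)
    ≡⟨ ≡.cong₂ ℤ._+_ (*ₚ-suc p r k) (*ₚ-suc q r k) ⟨
  ((p *ₚ r) +ₚ (q *ₚ r)) (suc k) ∎
  where
  open ≡.≡-Reasoning
  rearrange : ∀ a b c x y → (a ℤ.+ b) ℤ.* c ℤ.+ (x ℤ.+ y) ≡ a ℤ.* c ℤ.+ x ℤ.+ (b ℤ.* c ℤ.+ y)
  rearrange = ℤ-Solver.solve-∀

*ₚ-scaleˡ : ∀ c p q → (λ k → c ℤ.* p k) *ₚ q ≈ₚ (λ k → c ℤ.* (p *ₚ q) k)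
*ₚ-scaleˡ c p q zero    = ℤₚ.*-assoc c (p 0) (q 0)
*ₚ-scaleˡ c p q (suc k) = begin
  ((λ k → c ℤ.* p k) *ₚ q) (suc k) ≡⟨ *ₚ-suc (λ k → c ℤ.* p k) q k ⟩
  c ℤ.* p 0 ℤ.* q (suc k) ℤ.+ ((λ k → c ℤ.* p (suc k)) *ₚ q) k
    ≡⟨ ≡.cong₂ ℤ._+_ (ℤₚ.*-assoc c (p 0) _) (*ₚ-scaleˡ c (p ∘ suc) q k) ⟩
  c ℤ.* (p 0 ℤ.* q (suc k)) ℤ.+ c ℤ.* ((p ∘ suc) *ₚ q) k ≡⟨ ℤₚ.*-distribˡ-+ c _ _ ⟨
  c ℤ.* (p 0 ℤ.* q (suc k) ℤ.+ ((p ∘ suc) *ₚ q) k) ≡⟨ ≡.cong (λ z → c ℤ.* z) (*ₚ-suc p q k) ⟨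
  c ℤ.* (p *ₚ q) (suc k) ∎
  where open ≡.≡-Reasoning

*ₚ-assoc : ∀ p q r → (p *ₚ q) *ₚ r ≈ₚ p *ₚ (q *ₚ r)
*ₚ-assoc p q r zero    = ℤₚ.*-assoc (p 0) (q 0) (r 0)
*ₚ-assoc p q r (suc k) = begin
  ((p *ₚ q) *ₚ r) (suc k) ≡⟨ *ₚ-suc (p *ₚ q) r k ⟩
  p 0 ℤ.* q 0 ℤ.* r (suc k) ℤ.+ (((p *ₚ q) ∘ suc) *ₚ r) k
    ≡⟨ ≡.cong₂ ℤ._+_ (ℤₚ.*-assoc (p 0) (q 0) _) tail ⟩
  p 0 ℤ.* (q 0 ℤ.* r (suc k)) ℤ.+ (p 0 ℤ.* ((q ∘ suc) *ₚ r) k ℤ.+ ((p ∘ suc) *ₚ (q *ₚ r)) k)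
    ≡⟨ rearrange (p 0) (q 0 ℤ.* r (suc k)) _ _ ⟩
  p 0 ℤ.* (q 0 ℤ.* r (suc k) ℤ.+ ((q ∘ suc) *ₚ r) k) ℤ.+ ((p ∘ suc) *ₚ (q *ₚ r)) k
    ≡⟨ ≡.cong (λ z → p 0 ℤ.* z ℤ.+ ((p ∘ suc) *ₚ (q *ₚ r)) k) (*ₚ-suc q r k) ⟨
  p 0 ℤ.* (q *ₚ r) (suc k) ℤ.+ ((p ∘ suc) *ₚ (q *ₚ r)) k ≡⟨ *ₚ-suc p (q *ₚ r) k ⟨
  (p *ₚ (q *ₚ r)) (suc k) ∎
  where
  open ≡.≡-Reasoning
  rearrange : ∀ a x y z → a ℤ.* x ℤ.+ (a ℤ.* y ℤ.+ z) ≡ a ℤ.* (x ℤ.+ y) ℤ.+ z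
  rearrange = ℤ-Solver.solve-∀
  tail : (((p *ₚ q) ∘ suc) *ₚ r) k ≡ p 0 ℤ.* ((q ∘ suc) *ₚ r) k ℤ.+ ((p ∘ suc) *ₚ (q *ₚ r)) k
  tail = begin
    (((p *ₚ q) ∘ suc) *ₚ r) k ≡⟨ *ₚ-cong {s = r} (*ₚ-suc p q) (λ _ → ≡.refl) k ⟩
    (((λ i → p 0 ℤ.* q (suc i)) +ₚ ((p ∘ suc) *ₚ q)) *ₚ r) k
      ≡⟨ *ₚ-distribʳ r (λ i → p 0 ℤ.* q (suc i)) ((p ∘ suc) *ₚ q) k ⟩
    ((λ i → p 0 ℤ.* q (suc i)) *ₚ r) k ℤ.+ (((p ∘ suc) *ₚ q) *ₚ r) k
      ≡⟨ ≡.cong₂ ℤ._+_ (*ₚ-scaleˡ (p 0) (q ∘ suc) r k) (*ₚ-assoc (p ∘ suc) q r k) ⟩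
    p 0 ℤ.* ((q ∘ suc) *ₚ r) k ℤ.+ ((p ∘ suc) *ₚ (q *ₚ r)) k ∎

*ₚ-zeroˡ : ∀ p → 0ₚ *ₚ p ≈ₚ 0ₚ
*ₚ-zeroˡ p zero    = ℤₚ.*-zeroˡ (p 0)
*ₚ-zeroˡ p (suc k) = ≡.trans (*ₚ-suc 0ₚ p k) (≡.cong₂ ℤ._+_ (ℤₚ.*-zeroˡ (p (suc k))) (*ₚ-zeroˡ p k))

*ₚ-identityˡ : ∀ p → 1ₚ *ₚ p ≈ₚ p
*ₚ-identityˡ p zero    = ℤₚ.*-identityˡ (p 0)
*ₚ-identityˡ p (suc k) = ≡.trans (*ₚ-suc 1ₚ p k)
  (≡.trans (≡.cong₂ ℤ._+_ (ℤₚ.*-identityˡ (p (suc k))) (*ₚ-zeroˡ p k)) (ℤₚ.+-identityʳ (p (suc k))))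

polyRing : CommutativeRing 0ℓ 0ℓ
polyRing = record
  { Carrier = Poly ; _≈_ = _≈ₚ_ ; _+_ = _+ₚ_ ; _*_ = _*ₚ_ ; -_ = -ₚ_ ; 0# = 0ₚ ; 1# = 1ₚ
  ; isCommutativeRing = record
    { isRing = record
      { +-isAbelianGroup = record
        { isGroup = record
          { isMonoid = record
            { isSemigroup = record
              { isMagma = record
                { isEquivalence = record
                  { refl = λ _ → ≡.refl ; sym = λ e k → ≡.sym (e k) ; trans = λ e f k → ≡.trans (e k) (f k) }
                ; ∙-cong = λ e f k → ≡.cong₂ ℤ._+_ (e k) (f k) }
              ; assoc = λ p q r k → ℤₚ.+-assoc (p k) (q k) (r k) }
            ; identity = (λ p k → ℤₚ.+-identityˡ (p k)) , λ p k → ℤₚ.+-identityʳ (p k) }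
          ; inverse = (λ p k → ℤₚ.+-inverseˡ (p k)) , λ p k → ℤₚ.+-inverseʳ (p k)
          ; ⁻¹-cong = λ e k → ≡.cong ℤ.-_ (e k) }
        ; comm = λ p q k → ℤₚ.+-comm (p k) (q k) }
      ; *-cong = *ₚ-cong
      ; *-assoc = *ₚ-assoc
      ; *-identity = *ₚ-identityˡ , λ p k → ≡.trans (*ₚ-comm p 1ₚ k) (*ₚ-identityˡ p k)
      ; distrib = (λ r p q k → ≡.trans (*ₚ-comm r (p +ₚ q) k) (≡.trans (*ₚ-distribʳ r p q k)
                     (≡.cong₂ ℤ._+_ (*ₚ-comm p r k) (*ₚ-comm q r k)))) , *ₚ-distribʳ }
    ; *-comm = *ₚ-comm } }

tₚ : Poly
tₚ zero    = + 0
tₚ (suc k) = 1ₚ k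

tₚ*-suc : ∀ p k → (tₚ *ₚ p) (suc k) ≡ p k
tₚ*-suc p k = ≡.trans (*ₚ-suc tₚ p k)
  (≡.trans (≡.cong₂ ℤ._+_ (ℤₚ.*-zeroˡ (p (suc k))) (*ₚ-identityˡ p k)) (ℤₚ.+-identityˡ (p k)))

open CommutativeRing polyRing using (semiring; ring; *-congˡ; *-congʳ; *-cong; *-identityʳ; zeroʳ; distribˡ)
open Determinant polyRing
open MotzkinHankel polyRing (1ₚ +ₚ tₚ) tₚ
open import Algebra.Definitions.RawSemiring (Semiring.rawSemiring semiring) using (_^_)
open import Algebra.Properties.Ring ring using (-1*x≈-x)

-- Agreement of the two forms of the determinant

signed-≈ : ∀ e p → signed e p ≈ₚ (ε ^ e) *ₚ p
signed-≈ zero          p k = ≡.sym (*ₚ-identityˡ p k)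
signed-≈ (suc zero)    p k = ≡.sym (≡.trans (*-congʳ {p} (*-identityʳ ε) k) (-1*x≈-x p k))
signed-≈ (suc (suc e)) p k = begin
  signed e p k                     ≡⟨ signed-≈ e p k ⟩
  ((ε ^ e) *ₚ p) k                 ≡⟨ ℤₚ.neg-involutive _ ⟨
  (-ₚ (-ₚ ((ε ^ e) *ₚ p))) k       ≡⟨ ≡.cong ℤ.-_ (-1*x≈-x ((ε ^ e) *ₚ p) k) ⟨
  (-ₚ (ε *ₚ ((ε ^ e) *ₚ p))) k     ≡⟨ -1*x≈-x (ε *ₚ ((ε ^ e) *ₚ p)) k ⟨
  (ε *ₚ (ε *ₚ ((ε ^ e) *ₚ p))) k   ≡⟨ *-congˡ {ε} (*ₚ-assoc ε (ε ^ e) p) k ⟨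
  (ε *ₚ ((ε ^ suc e) *ₚ p)) k      ≡⟨ *ₚ-assoc ε (ε ^ suc e) p k ⟨
  ((ε ^ suc (suc e)) *ₚ p) k       ∎
  where open ≡.≡-Reasoning

sumFin-cong : ∀ {n} {f g : Fin n → Poly} → (∀ j → f j ≈ₚ g j) → sumFin f ≈ₚ sumFin g
sumFin-cong {zero}  eq k = ≡.refl
sumFin-cong {suc n} eq k = ≡.cong₂ ℤ._+_ (eq zero k) (sumFin-cong (eq ∘ suc) k)

-- The offset `e` makes the induction work: the tail of the sum begins with the next sign, which
-- `altSum` records as a factor `ε`.
sumFin-signed : ∀ {n} e {f : Fin n → Poly} {g} → (∀ j → f j ≈ₚ g (toℕ j)) →
                sumFin (λ j → signed (toℕ j ℕ.+ e) (f j)) ≈ₚ (ε ^ e) *ₚ altSum n g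
sumFin-signed {zero}  e eq k = ≡.sym (zeroʳ (ε ^ e) k)
sumFin-signed {suc n} e {f} {g} eq k = begin
  signed e (f zero) k ℤ.+ sumFin (λ j → signed (suc (toℕ j ℕ.+ e)) (f (suc j))) k
    ≡⟨ ≡.cong₂ ℤ._+_ (signed-≈ e (f zero) k) (sumFin-cong (λ j k → ≡.cong (λ i → signed i (f (suc j)) k)
         (≡.sym (ℕₚ.+-suc (toℕ j) e))) k) ⟩
  ((ε ^ e) *ₚ f zero) k ℤ.+ sumFin (λ j → signed (toℕ j ℕ.+ suc e) (f (suc j))) k
    ≡⟨ ≡.cong₂ ℤ._+_ (*-congˡ {ε ^ e} (eq zero) k) (sumFin-signed (suc e) (eq ∘ suc) k) ⟩
  ((ε ^ e) *ₚ g 0) k ℤ.+ ((ε ^ suc e) *ₚ altSum n (g ∘ suc)) k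
    ≡⟨ ≡.cong (λ z → ((ε ^ e) *ₚ g 0) k ℤ.+ z) (≡.trans (*-congʳ {altSum n (g ∘ suc)} (*ₚ-comm ε (ε ^ e)) k)
         (*ₚ-assoc (ε ^ e) ε (altSum n (g ∘ suc)) k)) ⟩
  ((ε ^ e) *ₚ g 0) k ℤ.+ ((ε ^ e) *ₚ (ε *ₚ altSum n (g ∘ suc))) k
    ≡⟨ distribˡ (ε ^ e) (g 0) (ε *ₚ altSum n (g ∘ suc)) k ⟨
  ((ε ^ e) *ₚ altSum (suc n) g) k ∎
  where open ≡.≡-Reasoning

toℕ-punchIn : ∀ {n} (j : Fin (suc n)) c → toℕ (punchIn j c) ≡ skip (toℕ j) (toℕ c)
toℕ-punchIn zero    c       = ≡.refl
toℕ-punchIn (suc j) zero    = ≡.refl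
toℕ-punchIn (suc j) (suc c) = ≡.cong suc (toℕ-punchIn j c)

det-≈ : ∀ n {M : Fin n → Fin n → Poly} {v} → (∀ i j → M i j ≈ₚ v (toℕ j) (toℕ i)) → det M ≈ₚ detℕ n v
det-≈ zero    eq k = ≡.refl
det-≈ (suc n) {M} {v} eq k = begin
  sumFin (λ j → signed (toℕ j) (term j)) k
    ≡⟨ sumFin-cong (λ j k → ≡.cong (λ e → signed e (term j) k) (ℕₚ.+-identityʳ (toℕ j))) k ⟨
  sumFin (λ j → signed (toℕ j ℕ.+ 0) (term j)) k
    ≡⟨ sumFin-signed 0 {g = λ j → v j 0 *ₚ detℕ n (minor v j)} (λ j → *-cong (eq zero j) (minors j)) k ⟩
  (1ₚ *ₚ detℕ (suc n) v) k ≡⟨ *ₚ-identityˡ (detℕ (suc n) v) k ⟩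
  detℕ (suc n) v k ∎
  where
  open ≡.≡-Reasoning
  term : Fin (suc n) → Poly
  term j = M zero j *ₚ det (λ r c → M (suc r) (punchIn j c))
  minors : ∀ j → det (λ r c → M (suc r) (punchIn j c)) ≈ₚ detℕ n (minor v (toℕ j))
  minors j = det-≈ n λ r c k → ≡.trans (eq (suc r) (punchIn j c) k)
    (≡.cong (λ l → v l (suc (toℕ r)) k) (toℕ-punchIn j c))

-- Narayana numbers and the closed form of the coefficients of w^l

-- The lower index is shifted by 2 so that Pascal's rule and the reflection need no boundary cases.
binomial₂ : ℕ → ℕ → ℤ
binomial₂ n       zero                = + 0
binomial₂ zero    (suc zero)          = + 0
binomial₂ zero    (suc (suc zero))    = + 1
binomial₂ zero    (suc (suc (suc k))) = + 0
binomial₂ (suc n) (suc k)             = binomial₂ n (suc k) ℤ.+ binomial₂ n k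

binomial₂-1 : ∀ n → binomial₂ n 1 ≡ + 0
binomial₂-1 zero    = ≡.refl
binomial₂-1 (suc n) = ≡.cong (λ z → z ℤ.+ + 0) (binomial₂-1 n)

binomial₂-C : ∀ n k → binomial₂ n (2 ℕ.+ k) ≡ + (n C k)
binomial₂-C zero    zero    = ≡.refl
binomial₂-C zero    (suc k) = ≡.refl
binomial₂-C (suc n) zero    = ≡.cong₂ ℤ._+_ (binomial₂-C n 0) (binomial₂-1 n)
binomial₂-C (suc n) (suc k) = ≡.trans (≡.cong₂ ℤ._+_ (binomial₂-C n (suc k)) (binomial₂-C n k))
  (≡.cong +_ (≡.trans (ℕₚ.+-comm (n C suc k) (n C k)) (nCk+nC[k+1]≡[n+1]C[k+1] n k)))

-- For W l (n + 1) = [w^(n+1-l)] (1 - t w²) ((1 + w) (1 + t w))^n, the coefficient of t^k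
-- is reflected n (k + 1) (k + l + 1); the shift in binomial₂ makes the value at index 0 vanish.
reflected : ℕ → ℕ → ℕ → ℤ
reflected n j e = binomial₂ n (suc j) ℤ.* binomial₂ n e ℤ.- binomial₂ n j ℤ.* binomial₂ n (suc e)

reflected-zero : ∀ n e → reflected n 0 e ≡ + 0
reflected-zero n e = ≡.trans (≡.cong (λ z → z ℤ.* binomial₂ n e ℤ.- + 0 ℤ.* binomial₂ n (suc e)) (binomial₂-1 n))
  (zeros (binomial₂ n e) (binomial₂ n (suc e)))
  where
  zeros : ∀ x y → + 0 ℤ.* x ℤ.- + 0 ℤ.* y ≡ + 0
  zeros = ℤ-Solver.solve-∀

-- Pascal's rule in both factors. The four terms correspond to the products 1, w, t w and t w² in (1
-- + w)(1 + t w), which are the steps of the recurrence of `W`.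
reflected-suc : ∀ n j e → reflected (suc n) (suc j) (suc (suc e)) ≡
  reflected n (suc j) (suc e) ℤ.+ (reflected n (suc j) (suc (suc e)) ℤ.+ reflected n j (suc e))
  ℤ.+ reflected n j (suc (suc e))
reflected-suc n j e = identity (binomial₂ n j) (binomial₂ n (1 ℕ.+ j)) (binomial₂ n (2 ℕ.+ j))
  (binomial₂ n (1 ℕ.+ e)) (binomial₂ n (2 ℕ.+ e)) (binomial₂ n (3 ℕ.+ e))
  where
  identity : ∀ a₀ a₁ a₂ p q r →
    (a₂ ℤ.+ a₁) ℤ.* (q ℤ.+ p) ℤ.- (a₁ ℤ.+ a₀) ℤ.* (r ℤ.+ q) ≡
    (a₂ ℤ.* p ℤ.- a₁ ℤ.* q) ℤ.+ ((a₂ ℤ.* q ℤ.- a₁ ℤ.* r) ℤ.+ (a₁ ℤ.* p ℤ.- a₀ ℤ.* q))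
    ℤ.+ (a₁ ℤ.* q ℤ.- a₀ ℤ.* r)
  identity = ℤ-Solver.solve-∀

-- The formula is Lagrange inversion for w = q φ(w) with φ = (1 + w)(1 + t w), where 1 - t w² is φ -
-- w φ'. The proof only checks that it satisfies the recurrence of `W`; at `l = 0` its two products
-- cancel.
W-coefficient : ∀ n l k → W l (suc n) k ≡ reflected n (suc k) (suc (k ℕ.+ l))
tW-coefficient : ∀ n l k → (tₚ *ₚ W l (suc n)) k ≡ reflected n k (k ℕ.+ l)

tW-coefficient n l zero    = ≡.trans (ℤₚ.*-zeroˡ (W l (suc n) 0)) (≡.sym (reflected-zero n l))
tW-coefficient n l (suc k) = ≡.trans (tₚ*-suc (W l (suc n)) k) (W-coefficient n l k)

W-coefficient n zero k = ≡.sym (≡.trans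
  (≡.cong (λ e → reflected n (suc k) (suc e)) (ℕₚ.+-identityʳ k))
  (cancel (binomial₂ n (suc k)) (binomial₂ n (2 ℕ.+ k))))
  where
  cancel : ∀ a b → b ℤ.* a ℤ.- a ℤ.* b ≡ + 0
  cancel = ℤ-Solver.solve-∀
W-coefficient zero (suc l) k = ≡.trans
  (≡.cong₂ ℤ._+_ (≡.cong (λ z → W l 0 k ℤ.+ z) (zeroʳ (1ₚ +ₚ tₚ) k)) (zeroʳ tₚ k))
  (≡.trans (≡.trans (ℤₚ.+-identityʳ _) (ℤₚ.+-identityʳ _)) (initial l k))
  where
  initial : ∀ l k → W l 0 k ≡ reflected 0 (suc k) (suc (k ℕ.+ suc l))
  initial zero    zero          = ≡.refl
  initial (suc l) zero          = ≡.refl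
  initial zero    (suc zero)    = ≡.refl
  initial (suc l) (suc zero)    = ≡.refl
  initial zero    (suc (suc k)) = ≡.refl
  initial (suc l) (suc (suc k)) = ≡.refl
W-coefficient (suc n) (suc l) k = begin
  W l (suc n) k ℤ.+ ((1ₚ +ₚ tₚ) *ₚ W (suc l) (suc n)) k ℤ.+ (tₚ *ₚ W (2 ℕ.+ l) (suc n)) k
    ≡⟨ ≡.cong₂ ℤ._+_ (≡.cong₂ ℤ._+_ (W-coefficient n l k) middle) (≡.trans (tW-coefficient n (2 ℕ.+ l) k)
         (≡.cong (reflected n k) (≡.trans (ℕₚ.+-suc k (suc l)) (≡.cong suc (ℕₚ.+-suc k l))))) ⟩
  reflected n (suc k) (suc (k ℕ.+ l))
    ℤ.+ (reflected n (suc k) (2 ℕ.+ (k ℕ.+ l)) ℤ.+ reflected n k (suc (k ℕ.+ l)))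
    ℤ.+ reflected n k (2 ℕ.+ (k ℕ.+ l))
    ≡⟨ reflected-suc n k (k ℕ.+ l) ⟨
  reflected (suc n) (suc k) (2 ℕ.+ (k ℕ.+ l))
    ≡⟨ ≡.cong (λ e → reflected (suc n) (suc k) (suc e)) (ℕₚ.+-suc k l) ⟨
  reflected (suc n) (suc k) (suc (k ℕ.+ suc l)) ∎
  where
  open ≡.≡-Reasoning
  middle : ((1ₚ +ₚ tₚ) *ₚ W (suc l) (suc n)) k ≡
           reflected n (suc k) (2 ℕ.+ (k ℕ.+ l)) ℤ.+ reflected n k (suc (k ℕ.+ l))
  middle = begin
    ((1ₚ +ₚ tₚ) *ₚ W (suc l) (suc n)) k ≡⟨ *ₚ-distribʳ (W (suc l) (suc n)) 1ₚ tₚ k ⟩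
    (1ₚ *ₚ W (suc l) (suc n)) k ℤ.+ (tₚ *ₚ W (suc l) (suc n)) k
      ≡⟨ ≡.cong₂ ℤ._+_ (≡.trans (*ₚ-identityˡ (W (suc l) (suc n)) k) (W-coefficient n (suc l) k))
                       (tW-coefficient n (suc l) k) ⟩
    reflected n (suc k) (suc (k ℕ.+ suc l)) ℤ.+ reflected n k (k ℕ.+ suc l)
      ≡⟨ ≡.cong (λ e → reflected n (suc k) (suc e) ℤ.+ reflected n k e) (ℕₚ.+-suc k l) ⟩
    reflected n (suc k) (2 ℕ.+ (k ℕ.+ l)) ℤ.+ reflected n k (suc (k ℕ.+ l)) ∎

-- The absorption rule (k + 1) C(n, k + 1) = (n - k) C(n, k), rearranged to avoid `n - k`.
binomial₂-absorb : ∀ n k → + suc k ℤ.* binomial₂ n (3 ℕ.+ k) ℤ.+ + k ℤ.* binomial₂ n (2 ℕ.+ k)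
                           ≡ + n ℤ.* binomial₂ n (2 ℕ.+ k)
binomial₂-absorb zero zero    = ≡.refl
binomial₂-absorb zero (suc k) = ≡.trans (≡.cong₂ ℤ._+_ (ℤₚ.*-zeroʳ (+ suc (suc k))) (ℤₚ.*-zeroʳ (+ suc k))) ≡.refl
binomial₂-absorb (suc n) zero = begin
  + 1 ℤ.* (D ℤ.+ B) ℤ.+ + 0 ℤ.* (B ℤ.+ A) ≡⟨ step D B A ⟩
  (+ 1 ℤ.* D ℤ.+ + 0 ℤ.* B) ℤ.+ B         ≡⟨ ≡.cong (λ z → z ℤ.+ B) (binomial₂-absorb n 0) ⟩
  + n ℤ.* B ℤ.+ B                         ≡⟨ step′ (+ n) B ⟩
  (+ 1 ℤ.+ + n) ℤ.* (B ℤ.+ + 0)           ≡⟨ ≡.cong (λ a → + suc n ℤ.* (B ℤ.+ a)) (binomial₂-1 n) ⟨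
  + suc n ℤ.* (B ℤ.+ A)                   ∎
  where
  open ≡.≡-Reasoning
  A = binomial₂ n 1
  B = binomial₂ n 2
  D = binomial₂ n 3
  step : ∀ d b a → + 1 ℤ.* (d ℤ.+ b) ℤ.+ + 0 ℤ.* (b ℤ.+ a) ≡ (+ 1 ℤ.* d ℤ.+ + 0 ℤ.* b) ℤ.+ b
  step = ℤ-Solver.solve-∀
  step′ : ∀ n b → n ℤ.* b ℤ.+ b ≡ (+ 1 ℤ.+ n) ℤ.* (b ℤ.+ + 0)
  step′ = ℤ-Solver.solve-∀
binomial₂-absorb (suc n) (suc k) = begin
  (+ 2 ℤ.+ K) ℤ.* (D ℤ.+ B) ℤ.+ (+ 1 ℤ.+ K) ℤ.* (B ℤ.+ A) ≡⟨ step K D B A ⟩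
  ((+ 2 ℤ.+ K) ℤ.* D ℤ.+ (+ 1 ℤ.+ K) ℤ.* B) ℤ.+ ((+ 1 ℤ.+ K) ℤ.* B ℤ.+ K ℤ.* A) ℤ.+ B ℤ.+ A
    ≡⟨ ≡.cong₂ (λ x y → x ℤ.+ y ℤ.+ B ℤ.+ A) (binomial₂-absorb n (suc k)) (binomial₂-absorb n k) ⟩
  + n ℤ.* B ℤ.+ + n ℤ.* A ℤ.+ B ℤ.+ A ≡⟨ step′ (+ n) B A ⟩
  (+ 1 ℤ.+ + n) ℤ.* (B ℤ.+ A) ∎
  where
  open ≡.≡-Reasoning
  K = + k
  A = binomial₂ n (2 ℕ.+ k)
  B = binomial₂ n (3 ℕ.+ k)
  D = binomial₂ n (4 ℕ.+ k)
  step : ∀ k d b a → (+ 2 ℤ.+ k) ℤ.* (d ℤ.+ b) ℤ.+ (+ 1 ℤ.+ k) ℤ.* (b ℤ.+ a) ≡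
    ((+ 2 ℤ.+ k) ℤ.* d ℤ.+ (+ 1 ℤ.+ k) ℤ.* b) ℤ.+ ((+ 1 ℤ.+ k) ℤ.* b ℤ.+ k ℤ.* a) ℤ.+ b ℤ.+ a
  step = ℤ-Solver.solve-∀
  step′ : ∀ n b a → n ℤ.* b ℤ.+ n ℤ.* a ℤ.+ b ℤ.+ a ≡ (+ 1 ℤ.+ n) ℤ.* (b ℤ.+ a)
  step′ = ℤ-Solver.solve-∀

-- The closed form gives the cofactor `z` only as an integer; it cannot be negative because `p` is
-- natural, so the division in ℕ is exact.
exact-quotient : ∀ p k z → + p ≡ + suc k ℤ.* z → + (p / suc k) ≡ z
exact-quotient p k (+ q)    eq = ≡.cong +_ (≡.trans
  (≡.cong (_/ suc k) (≡.trans (ℤₚ.+-injective (≡.trans eq (≡.sym (ℤₚ.pos-* (suc k) q)))) (ℕₚ.*-comm (suc k) q)))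
  (m*n/n≡m q (suc k)))
exact-quotient p k -[1+ q ] ()

-- The Narayana number as the determinant C(n, k)² - C(n, k - 1) C(n, k + 1). For three consecutive
-- binomials `A`, `B`, `D`, absorption evaluates both n A and n B; comparing the two values of n A B
-- eliminates n.
narayana-numerator : ∀ n k → + ((suc n C k) * (n C k)) ≡ + suc k ℤ.* reflected n (suc k) (2 ℕ.+ k)
narayana-numerator n k = begin
  + ((suc n C k) * (n C k))                         ≡⟨ ℤₚ.pos-* (suc n C k) (n C k) ⟩
  + (suc n C k) ℤ.* + (n C k)                       ≡⟨ ≡.cong₂ ℤ._*_ (binomial₂-C (suc n) k) (binomial₂-C n k) ⟨
  binomial₂ (suc n) (2 ℕ.+ k) ℤ.* binomial₂ n (2 ℕ.+ k) ≡⟨ shifted k ⟩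
  + suc k ℤ.* reflected n (suc k) (2 ℕ.+ k)         ∎
  where
  open ≡.≡-Reasoning
  shifted : ∀ k → binomial₂ (suc n) (2 ℕ.+ k) ℤ.* binomial₂ n (2 ℕ.+ k) ≡
                  + suc k ℤ.* reflected n (suc k) (2 ℕ.+ k)
  shifted zero    = ≡.subst (λ a → (B ℤ.+ a) ℤ.* B ≡ + 1 ℤ.* (B ℤ.* B ℤ.- a ℤ.* D))
    (≡.sym (binomial₂-1 n)) (identity B D)
    where
    B = binomial₂ n 2
    D = binomial₂ n 3
    identity : ∀ b d → (b ℤ.+ + 0) ℤ.* b ≡ + 1 ℤ.* (b ℤ.* b ℤ.- + 0 ℤ.* d)
    identity = ℤ-Solver.solve-∀
  shifted (suc k) = begin
    (B ℤ.+ A) ℤ.* B ≡⟨ identity₁ K A B ⟩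
    (+ 2 ℤ.+ K) ℤ.* (B ℤ.* B) ℤ.- ((+ 1 ℤ.+ K) ℤ.* B ℤ.+ K ℤ.* A) ℤ.* B ℤ.+ (+ 1 ℤ.+ K) ℤ.* (A ℤ.* B)
      ≡⟨ ≡.cong (λ z → (+ 2 ℤ.+ K) ℤ.* (B ℤ.* B) ℤ.- z ℤ.* B ℤ.+ (+ 1 ℤ.+ K) ℤ.* (A ℤ.* B))
           (binomial₂-absorb n k) ⟩
    (+ 2 ℤ.+ K) ℤ.* (B ℤ.* B) ℤ.- + n ℤ.* A ℤ.* B ℤ.+ (+ 1 ℤ.+ K) ℤ.* (A ℤ.* B)
      ≡⟨ identity₂ K (+ n) A B ⟩
    (+ 2 ℤ.+ K) ℤ.* (B ℤ.* B) ℤ.- A ℤ.* (+ n ℤ.* B) ℤ.+ (+ 1 ℤ.+ K) ℤ.* (A ℤ.* B)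
      ≡⟨ ≡.cong (λ z → (+ 2 ℤ.+ K) ℤ.* (B ℤ.* B) ℤ.- A ℤ.* z ℤ.+ (+ 1 ℤ.+ K) ℤ.* (A ℤ.* B))
           (binomial₂-absorb n (suc k)) ⟨
    (+ 2 ℤ.+ K) ℤ.* (B ℤ.* B) ℤ.- A ℤ.* ((+ 2 ℤ.+ K) ℤ.* D ℤ.+ (+ 1 ℤ.+ K) ℤ.* B)
      ℤ.+ (+ 1 ℤ.+ K) ℤ.* (A ℤ.* B)
      ≡⟨ identity₃ K A B D ⟩
    (+ 2 ℤ.+ K) ℤ.* (B ℤ.* B ℤ.- A ℤ.* D) ∎
    where
    K = + k
    A = binomial₂ n (2 ℕ.+ k)
    B = binomial₂ n (3 ℕ.+ k)
    D = binomial₂ n (4 ℕ.+ k)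
    identity₁ : ∀ k a b → (b ℤ.+ a) ℤ.* b ≡
      (+ 2 ℤ.+ k) ℤ.* (b ℤ.* b) ℤ.- ((+ 1 ℤ.+ k) ℤ.* b ℤ.+ k ℤ.* a) ℤ.* b ℤ.+ (+ 1 ℤ.+ k) ℤ.* (a ℤ.* b)
    identity₁ = ℤ-Solver.solve-∀
    identity₂ : ∀ k n a b →
      (+ 2 ℤ.+ k) ℤ.* (b ℤ.* b) ℤ.- n ℤ.* a ℤ.* b ℤ.+ (+ 1 ℤ.+ k) ℤ.* (a ℤ.* b) ≡
      (+ 2 ℤ.+ k) ℤ.* (b ℤ.* b) ℤ.- a ℤ.* (n ℤ.* b) ℤ.+ (+ 1 ℤ.+ k) ℤ.* (a ℤ.* b)
    identity₂ = ℤ-Solver.solve-∀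
    identity₃ : ∀ k a b d →
      (+ 2 ℤ.+ k) ℤ.* (b ℤ.* b) ℤ.- a ℤ.* ((+ 2 ℤ.+ k) ℤ.* d ℤ.+ (+ 1 ℤ.+ k) ℤ.* b)
        ℤ.+ (+ 1 ℤ.+ k) ℤ.* (a ℤ.* b) ≡
      (+ 2 ℤ.+ k) ℤ.* (b ℤ.* b ℤ.- a ℤ.* d)
    identity₃ = ℤ-Solver.solve-∀

narayana-W : ∀ n → narayana (suc n) ≈ₚ W 1 (suc n)
narayana-W n k = ≡.trans (exact-quotient ((suc n C k) * (n C k)) k _ (narayana-numerator n k))
  (≡.sym (≡.trans (W-coefficient n 1 k) (≡.cong (λ e → reflected n (suc k) (suc e)) (ℕₚ.+-comm k 1))))

-- The matrix entries and the theorem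

Σ≤-coefficient : ∀ n f k → Σ≤ n f k ≡ sumTo n (λ i → f i k)
Σ≤-coefficient zero    f k = ≡.refl
Σ≤-coefficient (suc n) f k = ≡.cong (λ z → z ℤ.+ f (suc n) k) (Σ≤-coefficient n f k)

gamma2m-W : ∀ m n → gamma2m m n ≈ₚ W m (m ℕ.+ n)
gamma2m-W zero    zero    k = ≡.refl
gamma2m-W zero    (suc n) k = ≡.refl
gamma2m-W (suc m) n       k = begin
  sumTo n (λ i → (narayana (suc i) *ₚ gamma2m m (n ∸ i)) k)
    ≡⟨ sumTo-cong n (λ i _ → *ₚ-cong (narayana-W i) (gamma2m-W m (n ∸ i)) k) ⟩
  sumTo n (λ i → (W 1 (suc i) *ₚ W m (m ℕ.+ (n ∸ i))) k)
    ≡⟨ Σ≤-coefficient n (λ i → W 1 (suc i) *ₚ W m (m ℕ.+ (n ∸ i))) k ⟨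
  Σ≤ n (λ i → W 1 (suc i) *ₚ W m (m ℕ.+ (n ∸ i))) k
    ≡⟨ W-power m n k ⟨
  W (suc m) (suc m ℕ.+ n) k ∎
  where open ≡.≡-Reasoning

-- The convention for negative indices agrees with the fact that w^m starts at q^m, so the case
-- distinction in `entry` disappears.
entry-W : ∀ m i j → entry m i j ≈ₚ W m (suc (i ℕ.+ j))
entry-W m i j k with m ℕ.≤? suc (i ℕ.+ j)
... | yes m≤ = ≡.trans (gamma2m-W m (suc (i ℕ.+ j) ∸ m) k) (≡.cong (λ N → W m N k) (ℕₚ.m+[n∸m]≡n m≤))
... | no  m≰ = ≡.sym (W-zero m (suc (i ℕ.+ j)) (ℕₚ.≰⇒> m≰) k)

Δ-hankel : ∀ μ N → Δ (suc μ) N ≈ₚ detℕ N (hankel μ)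
Δ-hankel μ N = det-≈ N λ i j k → ≡.trans (entry-W (suc μ) (toℕ i) (toℕ j) k)
  (≡.cong (λ s → W (suc μ) (suc s) k) (ℕₚ.+-comm (toℕ i) (toℕ j)))

tₚ^-monomial : ∀ e → tₚ ^ e ≈ₚ monomial (+ 1) e
tₚ^-monomial zero    zero    = ≡.refl
tₚ^-monomial zero    (suc k) = ≡.refl
tₚ^-monomial (suc e) zero    = ℤₚ.*-zeroˡ ((tₚ ^ e) 0)
tₚ^-monomial (suc e) (suc k) = ≡.trans (tₚ*-suc (tₚ ^ e) k) (≡.trans (tₚ^-monomial e k) shift)
  where
  shift : monomial (+ 1) e k ≡ monomial (+ 1) (suc e) (suc k)
  shift with k ℕ.≟ e | suc k ℕ.≟ suc e
  ... | yes _   | yes _  = ≡.refl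
  ... | yes k≡e | no  ≢  = contradiction (≡.cong suc k≡e) ≢
  ... | no  k≢e | yes ≡′ = contradiction (ℕₚ.suc-injective ≡′) k≢e
  ... | no  _   | no  _  = ≡.refl

signed-monomial : ∀ s e → signed s (monomial (+ 1) e) ≈ₚ monomial (signℤ s) e
signed-monomial zero          e k = ≡.refl
signed-monomial (suc zero)    e k with k ℕ.≟ e
... | yes _ = ≡.refl
... | no  _ = ≡.refl
signed-monomial (suc (suc s)) e k = signed-monomial s e k

triangle-double : ∀ n → triangle n * 2 ≡ n * (n ∸ 1)
triangle-double zero          = ≡.refl
triangle-double (suc zero)    = ≡.refl
triangle-double (suc (suc n)) = ≡.trans (ℕₚ.*-distribʳ-+ 2 (suc n) (triangle (suc n)))
  (≡.trans (≡.cong (λ z → suc n * 2 ℕ.+ z) (triangle-double (suc n))) (identity n))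
  where
  identity : ∀ n → suc n * 2 ℕ.+ suc n * n ≡ suc (suc n) * suc n
  identity = ℕ-Solver.solve-∀

half : ∀ a {b} → a * 2 ≡ b → b / 2 ≡ a
half a ≡.refl = m*n/n≡m a 2

theorem1p5 : (m N : ℕ) → m ≥ 1 →
    ((n : ℕ) → N ≡ m * n →
    Δ m N ≈ₚ monomial (signℤ ((n * m * (m ∸ 1)) / 2)) ((m * m * n * (n ∸ 1)) / 2))
    × (((n : ℕ) → N ≢ m * n) → Δ m N ≈ₚ 0ₚ)
theorem1p5 m@(suc μ) N _ = multiple , nonmultiple
  where
  open ≡.≡-Reasoning
  multiple : (n : ℕ) → N ≡ m * n →
    Δ m N ≈ₚ monomial (signℤ ((n * m * (m ∸ 1)) / 2)) ((m * m * n * (n ∸ 1)) / 2)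
  multiple n N≡ k = begin
    Δ m N k                        ≡⟨ Δ-hankel μ N k ⟩
    detℕ N (hankel μ) k            ≡⟨ ≡.cong (λ N → detℕ N (hankel μ) k) (≡.trans N≡ (ℕₚ.*-comm m n)) ⟩
    detℕ (n * m) (hankel μ) k      ≡⟨ detℕ-hankel μ n k ⟩
    ((ε ^ s) *ₚ (tₚ ^ e)) k        ≡⟨ *-congˡ {ε ^ s} (tₚ^-monomial e) k ⟩
    ((ε ^ s) *ₚ monomial (+ 1) e) k ≡⟨ signed-≈ s (monomial (+ 1) e) k ⟨
    signed s (monomial (+ 1) e) k  ≡⟨ signed-monomial s e k ⟩
    monomial (signℤ s) e k
      ≡⟨ ≡.cong₂ (λ s e → monomial (signℤ s) e k) (half s s-double) (half e e-double) ⟨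
    monomial (signℤ ((n * m * (m ∸ 1)) / 2)) ((m * m * n * (n ∸ 1)) / 2) k ∎
    where
    s = n * triangle m
    e = triangle n * (m * m)
    s-double : s * 2 ≡ n * m * (m ∸ 1)
    s-double = ≡.trans (ℕₚ.*-assoc n _ 2)
      (≡.trans (≡.cong (n *_) (triangle-double m)) (≡.sym (ℕₚ.*-assoc n m μ)))
    rearrange : ∀ τ m → τ * (m * m) * 2 ≡ m * m * (τ * 2)
    rearrange = ℕ-Solver.solve-∀
    e-double : e * 2 ≡ m * m * n * (n ∸ 1)
    e-double = ≡.trans (rearrange (triangle n) m)
      (≡.trans (≡.cong (m * m *_) (triangle-double n)) (≡.sym (ℕₚ.*-assoc (m * m) n (n ∸ 1))))
  nonmultiple : ((n : ℕ) → N ≢ m * n) → Δ m N ≈ₚ 0ₚ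
  nonmultiple N≢ k with N % m | m≡m%n+[m/n]*n N m | m%n<n N m
  ... | zero  | N≡ | _   = contradiction (≡.trans N≡ (ℕₚ.*-comm (N / m) m)) (N≢ (N / m))
  ... | suc r | N≡ | r<m = begin
    Δ m N k                                   ≡⟨ Δ-hankel μ N k ⟩
    detℕ N (hankel μ) k
      ≡⟨ ≡.cong (λ N → detℕ N (hankel μ) k) (≡.trans N≡ (ℕₚ.+-comm (suc r) _)) ⟩
    detℕ (N / m * m ℕ.+ suc r) (hankel μ) k   ≡⟨ detℕ-hankel-zero μ (N / m) r r<m k ⟩
    + 0                                       ∎
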